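{- Every signed graph $G$ with maximum average degree $\mathrm{mad}(G) < \frac{17}{5}$ admits a homomorphism to the signed graph $SP_9^+$. That is, $\chi_s(\mathcal{M}_{\frac{17}{5}}) \le 10$.
   Context: A signed graph $G=(V,E,s)$ is a finite simple graph $(V,E)$ (no loops, no parallel edges) together with a signature $s:E\to\{ -1,+1\}$; edges with sign $+1$ are positive, with sign $-1$ negative. Switching a vertex $v$ reverses the sign of every edge incident to $v$; two signed graphs are switching equivalent if one can be obtained from the other by a sequence of switches. For signed graphs $G$ and $H$, a map $\varphi:V(G)\to V(H)$ is a homomorphism if there is a signed graph $G'$ switching equivalent to $G$ such that for every edge $uv$ of $G'$, $\varphi(u)\varphi(v)$ is an edge of $H$ with the same sign as $uv$ in $G'$. The chromatic number $\chi_s(G)$ is the minimum order of a signed graph $H$ such that $G$ admits a homomorphism to $H$; for a class $\mathcal{C}$ of signed graphs, $\chi_s(\mathcal{C})$ is the maximum of $\chi_s(G)$ over $G\in\mathcal{C}$. The maximum average degree $\mathrm{mad}(G)$ is the maximum of $2|E(H)|/|V(H)|$ over all (nonempty) subgraphs $H$ of the underlying graph; $\mathcal{M}_k$ denotes the class of signed graphs with $\mathrm{mad} < k$. For a prime power $q\equiv 1 \pmod 4$, the signed Paley graph $SP_q$ has vertex set the finite field $\mathbb{F}_q$, and any two distinct vertices $u,v$ are joined by a positive edge if $u-v$ is a square in $\mathbb{F}_q$ and by a negative edge otherwise. For a signed graph $H$, $H^+$ denotes the signed graph obtained from $H$ by adding one new vertex joined by a positive edge to every vertex of $H$. Thus $SP_9^+$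 is a complete signed graph on $10$ vertices. -}

module Defs where

open import Algebra.Structures using (IsCommutativeRing)
open import Data.Bool.Base using (true; false; if_then_else_; _∨_)
open import Data.Bool.Properties using (∨-comm)
open import Data.Fin.Base as Fin using (Fin; zero; suc; toℕ; combine; remQuot)
open import Data.Fin.Properties as Fin using (_≟_; any?; all?)
open import Data.Fin.Subset using (Subset; inside; outside; ∣_∣; _∈_; ⊤; ⊥)
open import Data.Fin.Subset.Properties using (_∈?_; ∣⊤∣≡n; ∉⊥)
open import Data.Integer.Base using (+_)
open import Data.List.Base as List
  using (List; []; _∷_; _++_; map; mapMaybe; filter; foldl; length; allFin; cartesianProduct)
import Data.List.Extrema as Extrema
open import Data.List.Membership.Propositional using () renaming (_∈_ to _∈ˡ_)
open import Data.List.Membership.Propositional.Properties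
  using (∈-map⁺; ∈-map⁻; ∈-++⁺ˡ; ∈-++⁺ʳ; ∈-cartesianProduct⁺)
import Data.List.Relation.Unary.All as All
open import Data.List.Relation.Unary.Any using (here; there)
open import Data.Maybe.Base as Maybe using (Maybe; just; nothing)
import Data.Maybe.Properties as Maybe
open import Data.Nat.Base as ℕ using (ℕ; zero; suc; NonZero)
open import Data.Nat.DivMod using (_mod_)
import Data.Nat.Properties as ℕ
open import Data.Product.Base using (∃; _×_; _,_; proj₁; proj₂)
open import Data.Rational.Base as ℚ using (ℚ; 0ℚ; _/_)
import Data.Rational.Properties as ℚ
open import Data.Sign.Base as Sign using (Sign; opposite)
import Data.Sign.Properties as Sign
open import Data.Sum.Base using (_⊎_; inj₁; inj₂)
open import Data.Vec.Base using ([]; _∷_)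
open import Function.Base using (flip; id)
open import Relation.Binary.Bundles using (DecTotalOrder)
open import Relation.Binary.PropositionalEquality
  using (_≡_; _≢_; refl; sym; trans; cong; cong₂; subst; isEquivalence)
open import Relation.Nullary using (Dec; yes; no; does; contradiction; ¬?; _×-dec_; _→-dec_)
open import Relation.Nullary.Decidable using (from-yes)

private
  variable
    m n : ℕ

-- `adj x y` is `nothing` when x and y are not adjacent, and `just s` when
-- xy is an edge of sign s.
record SignedGraph (n : ℕ) : Set where
  field
    adj        : Fin n → Fin n → Maybe Sign
    adj-sym    : ∀ x y → adj x y ≡ adj y x
    adj-irrefl : ∀ x → adj x x ≡ nothing

open SignedGraph public

switch : Fin n → SignedGraph n → SignedGraph n
switch v G .adj x y =
  if does (x ≟ v) ∨ does (y ≟ v) then Maybe.map opposite (adj G x y) else adj G x y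
switch v G .adj-sym x y
  rewrite ∨-comm (does (x ≟ v)) (does (y ≟ v)) | adj-sym G x y = refl
switch v G .adj-irrefl x rewrite adj-irrefl G x with does (x ≟ v) ∨ does (x ≟ v)
... | true  = refl
... | false = refl

infix 4 _≈_ _∼_ _⟶_

_≈_ : SignedGraph n → SignedGraph n → Set
G ≈ H = ∀ x y → adj G x y ≡ adj H x y

_∼_ : SignedGraph n → SignedGraph n → Set
G ∼ H = ∃ λ vs → foldl (flip switch) G vs ≈ H

record _⟶_ (G : SignedGraph n) (H : SignedGraph m) : Set where
  field
    φ         : Fin n → Fin m
    G′        : SignedGraph n
    G∼G′      : G ∼ G′
    preserves : ∀ u v s → adj G′ u v ≡ just s → adj H (φ u) (φ v) ≡ just s

module _ (G : SignedGraph n) where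

  Edge : Fin n × Fin n → Set
  Edge (u , v) = u Fin.< v × adj G u v ≢ nothing

  edge? : ∀ e → Dec (Edge e)
  edge? (u , v) = u Fin.<? v ×-dec ¬? (Maybe.≡-dec Sign._≟_ (adj G u v) nothing)

  -- Each edge is listed once, smaller endpoint first.
  edges : List (Fin n × Fin n)
  edges = filter edge? (cartesianProduct (allFin n) (allFin n))

  Closed : Subset n → Subset (length edges) → Set
  Closed V E = ∀ i → i ∈ E → let (u , v) = List.lookup edges i in u ∈ V × v ∈ V

  closed? : ∀ V E → Dec (Closed V E)
  closed? V E = all? λ i → i ∈? E →-dec
    (let (u , v) = List.lookup edges i in u ∈? V ×-dec v ∈? V)

  -- Subgraphs need not be induced, so the edge set is chosen separately.
  record Subgraph : Set where
    field
      verts    : Subset n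
      edgs     : Subset (length edges)
      closed   : Closed verts edgs
      nonempty : NonZero ∣ verts ∣

subsets : ∀ n → List (Subset n)
subsets zero    = [] ∷ []
subsets (suc n) = map (inside ∷_) (subsets n) ++ map (outside ∷_) (subsets n)

subsets-complete : (p : Subset n) → p ∈ˡ subsets n
subsets-complete []            = here refl
subsets-complete (inside  ∷ p) = ∈-++⁺ˡ (∈-map⁺ (inside ∷_) (subsets-complete p))
subsets-complete {suc n} (outside ∷ p) =
  ∈-++⁺ʳ (map (inside ∷_) (subsets n)) (∈-map⁺ (outside ∷_) (subsets-complete p))

averageDegree : {G : SignedGraph n} → Subgraph G → ℚ
averageDegree S = (+ (2 ℕ.* ∣ edgs ∣) / ∣ verts ∣) ⦃ nonempty ⦄
  where open Subgraph S

open Extrema (DecTotalOrder.totalOrder ℚ.≤-decTotalOrder) using (max; xs≤max; argmax-sel)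

∈-mapMaybe⁺ : ∀ {A B : Set} (f : A → Maybe B) {x y xs} →
              x ∈ˡ xs → f x ≡ just y → y ∈ˡ mapMaybe f xs
∈-mapMaybe⁺ f {x} (here refl) eq rewrite eq = here refl
∈-mapMaybe⁺ f {xs = z ∷ _} (there x∈) eq with f z
... | just _  = there (∈-mapMaybe⁺ f x∈ eq)
... | nothing = ∈-mapMaybe⁺ f x∈ eq

module _ (G : SignedGraph n) where

  subgraph? : Subset n × Subset (length (edges G)) → Maybe (Subgraph G)
  subgraph? (V , E) with ℕ.nonZero? ∣ V ∣ | closed? G V E
  ... | yes ne | yes cl = just record { verts = V ; edgs = E ; closed = cl ; nonempty = ne }
  ... | _      | _      = nothing

  subgraphs : List (Subgraph G)
  subgraphs = mapMaybe subgraph? (cartesianProduct (subsets n) (subsets (length (edges G))))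

  -- Average degrees are nonnegative, so the base value 0 matters only for
  -- the graph without vertices, which has no nonempty subgraph.
  mad : ℚ
  mad = max 0ℚ (map averageDegree subgraphs)

  subgraph?-complete : (S : Subgraph G) → let open Subgraph S in
    ∃ λ cl → ∃ λ ne → subgraph? (verts , edgs) ≡
      just record { verts = verts ; edgs = edgs ; closed = cl ; nonempty = ne }
  subgraph?-complete S with ℕ.nonZero? ∣ Subgraph.verts S ∣
                          | closed? G (Subgraph.verts S) (Subgraph.edgs S)
  ... | yes ne | yes cl = cl , ne , refl
  ... | yes _  | no ¬cl = contradiction (Subgraph.closed S) ¬cl
  ... | no ¬ne | _      = contradiction (Subgraph.nonempty S) ¬ne

  subgraphs-complete : (S : Subgraph G) → let open Subgraph S in
    ∃ λ cl → ∃ λ ne →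
      record { verts = verts ; edgs = edgs ; closed = cl ; nonempty = ne } ∈ˡ subgraphs
  subgraphs-complete S =
    let (cl , ne , eq) = subgraph?-complete S
    in  cl , ne , ∈-mapMaybe⁺ subgraph?
          (∈-cartesianProduct⁺ (subsets-complete (Subgraph.verts S)) (subsets-complete (Subgraph.edgs S)))
          eq

  averageDegree≤mad : (S : Subgraph G) → averageDegree S ℚ.≤ mad
  averageDegree≤mad S =
    let (_ , _ , T∈) = subgraphs-complete S
    in  All.lookup (xs≤max 0ℚ (map averageDegree subgraphs)) (∈-map⁺ averageDegree T∈)

  0≤averageDegree : (S : Subgraph G) → 0ℚ ℚ.≤ averageDegree S
  0≤averageDegree S = ℚ.nonNegative⁻¹ (averageDegree S)
    ⦃ ℚ.normalize-nonNeg (2 ℕ.* ∣ edgs ∣) ∣ verts ∣ ⦃ nonempty ⦄ ⦄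
    where open Subgraph S

  mad-attained : .⦃ NonZero n ⦄ → ∃ λ (S : Subgraph G) → averageDegree S ≡ mad
  mad-attained = attained (argmax-sel id 0ℚ (map averageDegree subgraphs))
    where
    whole : Subgraph G
    whole = record
      { verts = ⊤ ; edgs = ⊥ ; closed = λ i i∈⊥ → contradiction i∈⊥ ∉⊥
      ; nonempty = ℕ.≢-nonZero λ eq → ℕ.≢-nonZero⁻¹ n (trans (sym (∣⊤∣≡n n)) eq) }

    attained : mad ≡ 0ℚ ⊎ mad ∈ˡ map averageDegree subgraphs →
               ∃ λ (S : Subgraph G) → averageDegree S ≡ mad
    attained (inj₁ mad≡0) = whole , ℚ.≤-antisym (averageDegree≤mad whole)
      (subst (ℚ._≤ averageDegree whole) (sym mad≡0) (0≤averageDegree whole))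
    attained (inj₂ mad∈) = let (S , _ , eq) = ∈-map⁻ averageDegree mad∈ in S , sym eq

IsMinimum IsMaximum : (ℕ → Set) → ℕ → Set
IsMinimum P k = P k × (∀ j → P j → k ℕ.≤ j)
IsMaximum P k = P k × (∀ j → P j → j ℕ.≤ k)

IsChromaticNumber : SignedGraph n → ℕ → Set
IsChromaticNumber G = IsMinimum λ k → ∃ λ (H : SignedGraph k) → G ⟶ H

Class : Set₁
Class = ∀ {n} → SignedGraph n → Set

IsClassChromaticNumber : Class → ℕ → Set
IsClassChromaticNumber 𝒞 = IsMaximum λ k →
  ∃ λ n → ∃ λ (G : SignedGraph n) → 𝒞 G × IsChromaticNumber G k

𝓜 : ℚ → Class
𝓜 k G = mad G ℚ.< k

-- 𝔽₉ = 𝔽₃[i] with i² = -1, where a + bi is encoded as 3a + b.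
module 𝔽₉ where

  ⟦_,_⟧ : ℕ → ℕ → Fin 9
  ⟦ a , b ⟧ = combine (a mod 3) (b mod 3)

  re im : Fin 9 → ℕ
  re x = toℕ (proj₁ (remQuot {3} 3 x))
  im x = toℕ (proj₂ (remQuot {3} 3 x))

  infixl 6 _+_ _-_
  infixl 7 _*_
  infix  8 -_

  _+_ _*_ : Fin 9 → Fin 9 → Fin 9
  x + y = ⟦ re x ℕ.+ re y , im x ℕ.+ im y ⟧
  x * y = ⟦ re x ℕ.* re y ℕ.+ 2 ℕ.* (im x ℕ.* im y) , re x ℕ.* im y ℕ.+ im x ℕ.* re y ⟧

  -_ : Fin 9 → Fin 9
  - x = ⟦ 2 ℕ.* re x , 2 ℕ.* im x ⟧

  0# 1# : Fin 9
  0# = ⟦ 0 , 0 ⟧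
  1# = ⟦ 1 , 0 ⟧

  isCommutativeRing : IsCommutativeRing _≡_ _+_ _*_ -_ 0# 1#
  isCommutativeRing = record
    { isRing = record
      { +-isAbelianGroup = record
        { isGroup = record
          { isMonoid = record
            { isSemigroup = record
              { isMagma = record { isEquivalence = isEquivalence ; ∙-cong = cong₂ _+_ }
              ; assoc = from-yes (all? λ x → all? λ y → all? λ z → (x + y) + z ≟ x + (y + z)) }
            ; identity = from-yes (all? λ x → 0# + x ≟ x) , from-yes (all? λ x → x + 0# ≟ x) }
          ; inverse = from-yes (all? λ x → - x + x ≟ 0#) , from-yes (all? λ x → x + - x ≟ 0#)
          ; ⁻¹-cong = cong -_ }
        ; comm = from-yes (all? λ x → all? λ y → x + y ≟ y + x) }
      ; *-cong = cong₂ _*_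
      ; *-assoc = from-yes (all? λ x → all? λ y → all? λ z → (x * y) * z ≟ x * (y * z))
      ; *-identity = from-yes (all? λ x → 1# * x ≟ x) , from-yes (all? λ x → x * 1# ≟ x)
      ; distrib =
          from-yes (all? λ x → all? λ y → all? λ z → x * (y + z) ≟ x * y + x * z) ,
          from-yes (all? λ x → all? λ y → all? λ z → (y + z) * x ≟ y * x + z * x) }
    ; *-comm = from-yes (all? λ x → all? λ y → x * y ≟ y * x) }

  invertible : ∀ x → x ≢ 0# → ∃ λ y → x * y ≡ 1#
  invertible = from-yes (all? λ x → ¬? (x ≟ 0#) →-dec any? λ y → x * y ≟ 1#)

  _-_ : Fin 9 → Fin 9 → Fin 9
  x - y = x + (- y)

  IsSquare : Fin 9 → Set
  IsSquare x = ∃ λ y → y * y ≡ x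

  isSquare? : ∀ x → Dec (IsSquare x)
  isSquare? x = any? λ y → y * y ≟ x

SP₉ : SignedGraph 9
SP₉ = record
  { adj        = joined
  ; adj-sym    = from-yes (all? λ u → all? λ v → Maybe.≡-dec Sign._≟_ (joined u v) (joined v u))
  ; adj-irrefl = from-yes (all? λ u → Maybe.≡-dec Sign._≟_ (joined u u) nothing)
  }
  where
  joined : Fin 9 → Fin 9 → Maybe Sign
  joined u v with u ≟ v | 𝔽₉.isSquare? (u 𝔽₉.- v)
  ... | yes _ | _     = nothing
  ... | no _  | yes _ = just Sign.+
  ... | no _  | no _  = just Sign.-

infix 10 _⁺

_⁺ : SignedGraph n → SignedGraph (suc n)
(H ⁺) .adj zero    zero    = nothing
(H ⁺) .adj zero    (suc _) = just Sign.+
(H ⁺) .adj (suc _) zero    = just Sign.+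
(H ⁺) .adj (suc x) (suc y) = adj H x y
(H ⁺) .adj-sym zero    zero    = refl
(H ⁺) .adj-sym zero    (suc _) = refl
(H ⁺) .adj-sym (suc _) zero    = refl
(H ⁺) .adj-sym (suc x) (suc y) = adj-sym H x y
(H ⁺) .adj-irrefl zero    = refl
(H ⁺) .adj-irrefl (suc x) = adj-irrefl H x

-- A homomorphism to SP₉⁺ is a proper coloring by the 20 vertices of its
-- antitwin cover, which is the Johnson graph J(6,3): s ≤ 2 pairwise
-- non-antipodal colors have 20, 9, 4 common neighbors.  Take a counterexample
-- that is minimal under deletion of edges, and call its vertices of degree at
-- most 2 light.  A light vertex only forbids one color at one of its neighbors,
-- depending on the color of the other, so it can be left uncolored until the
-- end; hence a vertex with s non-light and k ≥ 1 light neighbors has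
-- k ≥ 20, 9, 4 for s = 0, 1, 2.  Vertices with (s , k) = (3 , 0), (3 , 1) and
-- (2 , 4) are called medium: once the edge from such a vertex u to a neighbor
-- w is deleted and the rest colored, all but three colors of w allow u to be
-- recolored, so w cannot have too many medium neighbors.  Now give each vertex
-- v the charge 30 deg v - 102.  Non-light vertices give 21 to each light
-- neighbor, and those that are not medium give 4 to each (3 , 0)-neighbor and 3
-- to each other medium neighbor.  No charge ends up negative, so the average
-- degree of the non-isolated vertices is at least 102 / 30 = 17 / 5.

module Submission where

open import Defs
open import Data.Bool.Base using (Bool; true; false; T; if_then_else_)
open import Data.Bool.Properties using (T?; ∨-comm)
open import Data.Empty using (⊥)
open import Data.Fin.Base using (Fin; zero; suc)
import Data.Fin.Properties as Fin
import Data.Integer.Base as ℤ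
import Data.Integer.Properties as ℤ
open import Data.Fin.Subset as Subset using (Subset; ∣_∣)
open import Data.List.Base as List using
  (List; []; _∷_; _++_; length; filter; map; concatMap;
  allFin; cartesianProduct)
open import Data.List.Membership.Propositional using (_∈_; _∉_; find; lose)
open import Data.List.Membership.Propositional.Properties
  using (∈-filter⁺; ∈-filter⁻; ∈-map⁺; ∈-concatMap⁺; ∈-++⁺ˡ; ∈-++⁺ʳ; ∈-length;
         ∈-cartesianProduct⁺; ∈-cartesianProduct⁻; ∈-allFin)
import Data.List.Properties as List
open import Data.List.Relation.Unary.All as All using (All; []; _∷_)
open import Data.List.Relation.Unary.All.Properties using (¬All⇒Any¬)
open import Data.List.Relation.Unary.AllPairs using ([]; _∷_)
open import Data.List.Relation.Unary.Any as Any using (Any; here; there)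
open import Data.List.Relation.Unary.Unique.Propositional using (Unique)
import Data.List.Relation.Unary.Unique.Propositional.Properties as Unique
open import Data.Maybe.Base as Maybe using (Maybe; just; nothing; fromMaybe)
import Data.Maybe.Properties as Maybe
open import Data.Nat.Base using (ℕ; zero; suc; _+_; _*_; _≤_; _<_; z≤n; s≤s; NonZero; >-nonZero)
open import Data.Nat.ListAction using (sum)
import Data.Nat.Properties as ℕ
open import Data.Nat.Tactic.RingSolver using (solve-∀)
open import Data.Product.Base using (∃; _×_; _,_; proj₁; proj₂)
import Data.Product.Properties as ×
open import Data.Rational.Base as ℚ using (_/_)
import Data.Rational.Properties as ℚ
import Data.Rational.Unnormalised.Base as ℚᵘ
import Data.Rational.Unnormalised.Properties as ℚᵘ
open import Data.Sign.Base as Sign using (Sign; opposite)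
import Data.Sign.Properties as Sign
open import Data.Sum.Base using (_⊎_; inj₁; inj₂; [_,_]′)
open import Data.Vec.Base as Vec using (Vec; []; _∷_; lookup)
open import Data.Vec.Functional as VF using (updateAt)
open import Data.Vec.Functional.Properties using (updateAt-updates; updateAt-minimal)
open import Data.Vec.Properties using (lookup∘tabulate; lookup⇒[]=; []=⇒lookup)
open import Function.Base using (_∘_; id; flip; case_of_)
open import Relation.Binary.Definitions using (DecidableEquality; tri<; tri≈; tri>)
open import Relation.Binary.PropositionalEquality
  using (_≡_; _≢_; refl; sym; trans; cong; cong₂; subst; subst₂; ≢-sym)
open import Relation.Nullary
  using (Dec; yes; no; does; ¬_; ¬?; contradiction; _×-dec_; _⊎-dec_; _→-dec_)
open import Relation.Nullary.Decidable using (from-yes; map′; ¬¬-excluded-middle; dec-true; dec-false)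

-- Recoloring goes from `w` to its medium neighbors. The colors that `w` must avoid for the sake of
-- `u` are therefore fixed from the old coloring, before the new colors of `w` and of a second
-- changed vertex `e` are known. This order of quantifiers shapes the extension lemmas. The charge
-- `30 d - 102` is six times `5 d - 17`. A vertex of degree 2 lacks 42 = 2 * 21. After paying its
-- light neighbors, a (3 , 0)-vertex lacks 12 = 3 * 4, a (2 , 4)-vertex 6 = 2 * 3 and a (3 ,
-- 1)-vertex 3, while a (3 , 2)-vertex has exactly 6 left. The last is the critical case: it must be
-- shown that three medium neighbors do not occur there, and that two of them share a light vertex,
-- so that neither is a (3 , 0)-vertex asking for 4.

module Remove {A : Set} (_≟_ : DecidableEquality A) where

  infixl 6 _∖_

  _∖_ : List A → A → List A
  xs ∖ y = filter (λ x → ¬? (x ≟ y)) xs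

  ∈-∖⁺ : ∀ {xs x y} → x ∈ xs → x ≢ y → x ∈ xs ∖ y
  ∈-∖⁺ = ∈-filter⁺ (λ x → ¬? (x ≟ _))

  ∈-∖⁻ : ∀ {xs x y} → x ∈ xs ∖ y → x ∈ xs × x ≢ y
  ∈-∖⁻ = ∈-filter⁻ (λ x → ¬? (x ≟ _))

  ∖-unique : ∀ {xs y} → Unique xs → Unique (xs ∖ y)
  ∖-unique = Unique.filter⁺ (λ x → ¬? (x ≟ _))

  length-∖-< : ∀ {xs y} → y ∈ xs → length (xs ∖ y) < length xs
  length-∖-< {xs} y∈ =
    List.filter-notAll (λ x → ¬? (x ≟ _)) xs (Any.map (λ { refl x≢y → x≢y refl }) y∈)

  length-∖-≥ : ∀ {xs} y → Unique xs → length xs ≤ suc (length (xs ∖ y))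
  length-∖-≥ y [] = z≤n
  length-∖-≥ {x ∷ xs} y (x∉ ∷ u) with x ≟ y
  ... | no _ = s≤s (length-∖-≥ y u)
  ... | yes refl rewrite List.filter-all (λ z → ¬? (z ≟ x)) (All.map ≢-sym x∉) = ℕ.≤-refl

  fresh : ∀ {xs} F → Unique xs → length F < length xs → ∃ λ x → x ∈ xs × x ∉ F
  fresh {x ∷ _} [] u _ = x , here refl , λ ()
  fresh {xs} (y ∷ F) u F< =
    let x , x∈ , x∉F = fresh F (∖-unique u)
                         (ℕ.≤-pred (ℕ.≤-trans F< (length-∖-≥ y u)))
        x∈′ , x≢y = ∈-∖⁻ x∈
    in  x , x∈′ , λ where
          (here x≡y) → x≢y x≡y
          (there x∈F) → x∉F x∈F

-- The antitwin cover of SP₉⁺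

-- The vertex (x , s) of the antitwin cover of SP₉⁺ stands for x switched by s.
Color : Set
Color = Fin 10 × Sign

infix 4 _≟ᶜ_

_≟ᶜ_ : DecidableEquality Color
_≟ᶜ_ = ×.≡-dec Fin._≟_ Sign._≟_

infixr 7 _∙_

_∙_ : Sign → Color → Color
s ∙ (x , t) = x , s Sign.* t

neg : Color → Color
neg = Sign.- ∙_

-- The adjacency matrix of SP₉⁺, tabulated so that the exhaustive checks below evaluate fast.
matrix : Vec (Vec (Maybe Sign) 10) 10
matrix =
  (o ∷ p ∷ p ∷ p ∷ p ∷ p ∷ p ∷ p ∷ p ∷ p ∷ []) ∷
  (p ∷ o ∷ p ∷ p ∷ p ∷ m ∷ m ∷ p ∷ m ∷ m ∷ []) ∷
  (p ∷ p ∷ o ∷ p ∷ m ∷ p ∷ m ∷ m ∷ p ∷ m ∷ []) ∷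
  (p ∷ p ∷ p ∷ o ∷ m ∷ m ∷ p ∷ m ∷ m ∷ p ∷ []) ∷
  (p ∷ p ∷ m ∷ m ∷ o ∷ p ∷ p ∷ p ∷ m ∷ m ∷ []) ∷
  (p ∷ m ∷ p ∷ m ∷ p ∷ o ∷ p ∷ m ∷ p ∷ m ∷ []) ∷
  (p ∷ m ∷ m ∷ p ∷ p ∷ p ∷ o ∷ m ∷ m ∷ p ∷ []) ∷
  (p ∷ p ∷ m ∷ m ∷ p ∷ m ∷ m ∷ o ∷ p ∷ p ∷ []) ∷
  (p ∷ m ∷ p ∷ m ∷ m ∷ p ∷ m ∷ p ∷ o ∷ p ∷ []) ∷
  (p ∷ m ∷ m ∷ p ∷ m ∷ m ∷ p ∷ p ∷ p ∷ o ∷ []) ∷ []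
  where
  o p m : Maybe Sign
  o = nothing
  p = just Sign.+
  m = just Sign.-

entry : Fin 10 → Fin 10 → Maybe Sign
entry x y = lookup (lookup matrix x) y

entry-correct : ∀ x y → adj (SP₉ ⁺) x y ≡ entry x y
entry-correct = from-yes (Fin.all? λ x → Fin.all? λ y →
  Maybe.≡-dec Sign._≟_ (adj (SP₉ ⁺) x y) (entry x y))

isJust : Maybe Sign → Sign → Bool
isJust nothing  _ = false
isJust (just s) t = does (s Sign.≟ t)

pos : Color → Color → Bool
pos (x , s) (y , t) = isJust (entry x y) (s Sign.* t)

record Pos (p q : Color) : Set where
  constructor ⟨_⟩
  field holds : T (pos p q)

Pos? : ∀ p q → Dec (Pos p q)
Pos? p q = map′ ⟨_⟩ Pos.holds (T? (pos p q))

∀ᶜ? : ∀ {P : Color → Set} → (∀ p → Dec (P p)) → Dec (∀ p → P p)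
∀ᶜ? P? = map′ (λ { f (x , Sign.+) → proj₁ (f x) ; f (x , Sign.-) → proj₂ (f x) })
              (λ g x → g (x , Sign.+) , g (x , Sign.-))
              (Fin.all? λ x → P? (x , Sign.+) ×-dec P? (x , Sign.-))

signs : List Sign
signs = Sign.+ ∷ Sign.- ∷ []

-- Opaque, so that the twenty entries unfold only inside the exhaustive checks.
opaque

  colors : List Color
  colors = cartesianProduct (allFin 10) signs

  ∈-colors : ∀ p → p ∈ colors
  ∈-colors (x , Sign.+) = ∈-cartesianProduct⁺ {xs = allFin 10} {ys = signs} (∈-allFin x) (here refl)
  ∈-colors (x , Sign.-) = ∈-cartesianProduct⁺ {xs = allFin 10} {ys = signs} (∈-allFin x) (there (here refl))

  colors-unique : Unique colors
  colors-unique = Unique.cartesianProduct⁺ (Unique.allFin⁺ 10) (((λ ()) ∷ []) ∷ [] ∷ [])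

  length-colors : length colors ≡ 20
  length-colors = refl

common? : ∀ as (p : Color) → Dec (All (Pos p) as)
common? as p = All.all? (Pos? p) as

common : List Color → List Color
common as = filter (common? as) colors

∈-common⁺ : ∀ {as p} → All (Pos p) as → p ∈ common as
∈-common⁺ {as} {p} = ∈-filter⁺ (common? as) (∈-colors p)

∈-common⁻ : ∀ {as p} → p ∈ common as → All (Pos p) as
∈-common⁻ {as} p∈ = proj₂ (∈-filter⁻ (common? as) {xs = colors} p∈)

common-unique : ∀ as → Unique (common as)
common-unique as = Unique.filter⁺ (common? as) colors-unique

Bad : List Color → (a b q y : Color) → Set
Bad ps a b q y = y ≢ neg a × y ≢ neg b × All (λ p → ¬ (Pos p y × p ≢ q)) ps

bad? : ∀ ps a b q y → Dec (Bad ps a b q y)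
bad? ps a b q y = ¬? (y ≟ᶜ neg a) ×-dec ¬? (y ≟ᶜ neg b) ×-dec
  All.all? (λ p → ¬? (Pos? p y ×-dec ¬? (p ≟ᶜ q))) ps

FewBad : List Color → (a b : Color) → Set
FewBad ps a b = ∀ q → length (filter (bad? ps a b q) colors) ≤ 1

fewBad? : ∀ ps a b → Dec (FewBad ps a b)
fewBad? ps a b = ∀ᶜ? λ q → length (filter (bad? ps a b q) colors) ℕ.≤? 1

opaque
  unfolding colors

  length-common₁ : ∀ a → 9 ≤ length (common (a ∷ []))
  length-common₁ = from-yes (∀ᶜ? λ a → 9 ℕ.≤? length (common (a ∷ [])))

  length-common₂ : ∀ a b → a ≢ neg b → 4 ≤ length (common (a ∷ b ∷ []))
  length-common₂ = from-yes (∀ᶜ? λ a → ∀ᶜ? λ b → ¬? (a ≟ᶜ neg b) →-dec (4 ℕ.≤? length (common (a ∷ b ∷ []))))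

opaque
  unfolding colors

  length-common₃ : ∀ a b c → a ≢ b → a ≢ c → b ≢ c → length (common (a ∷ b ∷ c ∷ [])) ≤ 2
  length-common₃ = from-yes (∀ᶜ? λ a → ∀ᶜ? λ b → ∀ᶜ? λ c →
    ¬? (a ≟ᶜ b) →-dec ¬? (a ≟ᶜ c) →-dec ¬? (b ≟ᶜ c) →-dec (length (common (a ∷ b ∷ c ∷ [])) ℕ.≤? 2))

opaque
  unfolding colors

  -- Source of the three bad colors in the `FewLight` case: `neg a`, `neg b` and the single color
  -- counted here. The case `a ≡ b` is included and serves vertices with one constraint only.
  few-bad : ∀ a b → a ≢ neg b → FewBad (common (a ∷ b ∷ [])) a b
  few-bad = from-yes (∀ᶜ? λ a → ∀ᶜ? λ b →
    ¬? (a ≟ᶜ neg b) →-dec fewBad? (common (a ∷ b ∷ [])) a b)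

open Remove _≟ᶜ_ using (fresh)

-- Signs acting on colors, and counting common neighbors

entry-sym : ∀ x y → entry x y ≡ entry y x
entry-sym = from-yes (Fin.all? λ x → Fin.all? λ y → Maybe.≡-dec Sign._≟_ (entry x y) (entry y x))

Pos-sym : ∀ {p q} → Pos p q → Pos q p
Pos-sym {x , s} {y , t} ⟨ h ⟩ = ⟨ subst T (cong₂ isJust (entry-sym x y) (Sign.*-comm s t)) h ⟩

Pos-∙⁺ : ∀ s {p q} → Pos (s ∙ p) q → Pos p (s ∙ q)
Pos-∙⁺ s {x , a} {y , t} ⟨ h ⟩ = ⟨ subst (T ∘ isJust (entry x y)) eq h ⟩
  where
  eq : (s Sign.* a) Sign.* t ≡ a Sign.* (s Sign.* t)
  eq = trans (cong (Sign._* t) (Sign.*-comm s a)) (Sign.*-assoc a s t)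

Pos-∙⁻ : ∀ s {p q} → Pos p (s ∙ q) → Pos (s ∙ p) q
Pos-∙⁻ s h = Pos-sym (Pos-∙⁺ s (Pos-sym h))

∙-involutive : ∀ s p → s ∙ s ∙ p ≡ p
∙-involutive s (x , t) = cong (x ,_) (trans (sym (Sign.*-assoc s s t)) (cong (Sign._* t) (Sign.s*s≡+ s)))

∙-comm : ∀ s t p → s ∙ t ∙ p ≡ t ∙ s ∙ p
∙-comm s t (x , u) = cong (x ,_) (trans (sym (Sign.*-assoc s t u))
  (trans (cong (Sign._* u) (Sign.*-comm s t)) (Sign.*-assoc t s u)))

isJust-opposite : ∀ m {s} → T (isJust m s) → ¬ T (isJust m (opposite s))
isJust-opposite (just Sign.+) {Sign.+} _ ()
isJust-opposite (just Sign.-) {Sign.-} _ ()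

Pos-neg : ∀ {p q} → Pos p q → ¬ Pos p (neg q)
Pos-neg {x , s} {y , t} ⟨ h ⟩ h′ =
  isJust-opposite (entry x y) h
    (subst (T ∘ isJust (entry x y)) (minus-* s t) (Pos.holds (Pos-∙⁻ Sign.- h′)))
  where
  minus-* : ∀ s t → (Sign.- Sign.* s) Sign.* t ≡ opposite (s Sign.* t)
  minus-* Sign.+ t = refl
  minus-* Sign.- t = sym (Sign.opposite-involutive t)

-- Antipodal colors have disjoint neighborhoods, so an existing color of a vertex certifies that the
-- signed colors around it are pairwise non-antipodal.
common-neighbor⇒≢neg : ∀ {p a b} → Pos p a → Pos p b → a ≢ neg b
common-neighbor⇒≢neg pa pb refl = Pos-neg pb pa

avail₁ : ∀ a F → length F < 9 → ∃ λ p → Pos p a × p ∉ F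
avail₁ a F F< =
  let p , p∈ , p∉ = fresh F (common-unique (a ∷ [])) (ℕ.<-≤-trans F< (length-common₁ a))
  in  p , All.head (∈-common⁻ {a ∷ []} p∈) , p∉

avail₂ : ∀ a b → a ≢ neg b → ∀ F → length F < 4 → ∃ λ p → Pos p a × Pos p b × p ∉ F
avail₂ a b a≢-b F F< =
  let p , p∈ , p∉ = fresh F (common-unique (a ∷ b ∷ [])) (ℕ.<-≤-trans F< (length-common₂ a b a≢-b))
      p-ab = ∈-common⁻ {a ∷ b ∷ []} p∈
  in  p , All.head p-ab , All.head (All.tail p-ab) , p∉

-- The number of vertices of the cover adjacent to s pairwise non-antipodal ones, at least for s ≤ 2.
available : ℕ → ℕ
available 0 = 20
available 1 = 9
available 2 = 4
available _ = 0

-- In use, `p₀` is the old color of the vertex. From three constraints on, `available` is 0 and the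
-- bound on `F` is absurd.
avail : ∀ as {p₀} → All (Pos p₀) as → ∀ F → length F < available (length as) →
        ∃ λ p → All (Pos p) as × p ∉ F
avail [] _ F F< = let p , _ , p∉ = fresh F colors-unique (subst (length F <_) (sym length-colors) F<) in p , [] , p∉
avail (a ∷ []) _ F F< = let p , pa , p∉ = avail₁ a F F< in p , pa ∷ [] , p∉
avail (a ∷ b ∷ []) (p₀a ∷ p₀b ∷ []) F F< =
  let p , pa , pb , p∉ = avail₂ a b (common-neighbor⇒≢neg p₀a p₀b) F F<
  in  p , pa ∷ pb ∷ [] , p∉

available-anti : ∀ {m n} → m ≤ n → available n ≤ available m
available-anti {0} {0} _ = ℕ.≤-refl
available-anti {0} {1} _ = ℕ.m≤n+m 9 11
available-anti {0} {2} _ = ℕ.m≤n+m 4 16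
available-anti {0} {suc (suc (suc _))} _ = z≤n
available-anti {1} {1} _ = ℕ.≤-refl
available-anti {1} {2} _ = ℕ.m≤n+m 4 5
available-anti {1} {suc (suc (suc _))} _ = z≤n
available-anti {2} {2} _ = ℕ.≤-refl
available-anti {2} {suc (suc (suc _))} _ = z≤n
available-anti {suc (suc (suc _))} {suc (suc (suc _))} _ = z≤n
available-anti {suc (suc (suc _))} {1} (s≤s ())
available-anti {suc (suc (suc _))} {2} (s≤s (s≤s ()))
available-anti {2} {1} (s≤s ())

-- Besides -a and -b, at most one y is such that a, b and y have no common
-- neighbor other than a given color.
extend₃ : ∀ a b → a ≢ neg b → ∀ qs → length qs ≤ 1 → ∃ λ x →
  ∀ {y} → y ≢ neg a → y ≢ neg b → y ≢ x → ∃ λ p → Pos p a × Pos p b × Pos p y × p ∉ qs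
extend₃ a b a≢-b (_ ∷ _ ∷ _) (s≤s ())
extend₃ a b a≢-b [] _ =
  -- Any color can stand in for the missing `q`: excluding one only strengthens the result.
  let x , f = extend₃ a b a≢-b (a ∷ []) (s≤s z≤n)
  in  x , λ y≢-a y≢-b y≢x → let p , pa , pb , py , _ = f y≢-a y≢-b y≢x in p , pa , pb , py , λ ()
extend₃ a b a≢-b (q ∷ []) _ = exceptional , λ {y} → extend y
  where
  ps : List Color
  ps = common (a ∷ b ∷ [])
  one : List Color → Color
  -- Without a bad color the default is harmless, since it merely excludes one more `y`.
  one []      = a
  one (x ∷ _) = x
  exceptional : Color
  exceptional = one (filter (bad? ps a b q) colors)
  ∈-one : ∀ {xs y} → length xs ≤ 1 → y ∈ xs → y ≡ one xs
  ∈-one {_ ∷ []} _ (here y≡) = y≡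
  ∈-one {_ ∷ _ ∷ _} (s≤s ()) _
  extend : ∀ y → y ≢ neg a → y ≢ neg b → y ≢ exceptional →
           ∃ λ p → Pos p a × Pos p b × Pos p y × p ∉ (q ∷ [])
  extend y y≢-a y≢-b y≢x =
    case All.all? (λ p → ¬? (Pos? p y ×-dec ¬? (p ≟ᶜ q))) ps of λ where
      (yes all) → contradiction
        (∈-one (few-bad a b a≢-b q) (∈-filter⁺ (bad? ps a b q) (∈-colors y) (y≢-a , y≢-b , all)))
        y≢x
      (no ¬all) → case find (¬All⇒Any¬ (λ p → ¬? (Pos? p y ×-dec ¬? (p ≟ᶜ q))) ps ¬all) of λ where
        (p , p∈ , ¬¬ok) → case Pos? p y ×-dec ¬? (p ≟ᶜ q) of λ where
          (yes (py , p≢q)) → case ∈-common⁻ {a ∷ b ∷ []} p∈ of λ where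
            (pa ∷ pb ∷ []) → p , pa , pb , py , λ { (here p≡q) → p≢q p≡q }
          (no ¬ok) → contradiction ¬ok ¬¬ok

-- The `FewLight` case: apart from `w`, at most two constraints and one forbidden color. A lone
-- constraint is used twice in `extend₃`.
extendₐ : ∀ as {p₀} → All (Pos p₀) as → length as ≤ 2 → ∀ qs → length qs ≤ 1 →
  ∃ λ bad → length bad ≤ 3 × (∀ {y} → y ∉ bad → ∃ λ p → Pos p y × All (Pos p) as × p ∉ qs)
extendₐ [] _ _ qs qs≤ = [] , z≤n , λ {y} _ →
  let p , py , p∉ = avail₁ y qs (ℕ.≤-<-trans qs≤ (ℕ.m≤m+n 2 7)) in p , py , [] , p∉
extendₐ (a ∷ []) (p₀a ∷ []) _ qs qs≤ =
  let x , f = extend₃ a a (common-neighbor⇒≢neg p₀a p₀a) qs qs≤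
  in  neg a ∷ neg a ∷ x ∷ [] , ℕ.≤-refl , λ y∉ →
        let p , pa , _ , py , p∉ = f (y∉ ∘ here) (y∉ ∘ here) (y∉ ∘ there ∘ there ∘ here)
        in  p , py , pa ∷ [] , p∉
extendₐ (a ∷ b ∷ []) (p₀a ∷ p₀b ∷ []) _ qs qs≤ =
  let x , f = extend₃ a b (common-neighbor⇒≢neg p₀a p₀b) qs qs≤
  in  neg a ∷ neg b ∷ x ∷ [] , ℕ.≤-refl , λ y∉ →
        let p , pa , pb , py , p∉ = f (y∉ ∘ here) (y∉ ∘ there ∘ here) (y∉ ∘ there ∘ there ∘ here)
        in  p , py , pa ∷ pb ∷ [] , p∉
extendₐ (_ ∷ _ ∷ _ ∷ _) _ (s≤s (s≤s ())) _ _

-- Of two antipodal colors only one is adjacent to y, so avoiding both costs one color.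
avail₂± : ∀ a y → y ≢ neg a → ∀ qs {qs′} → length qs′ ≤ 2 →
  (∀ {p} → Pos p y → p ∈ qs → p ∈ qs′) → ∀ r →
  ∃ λ p → Pos p a × Pos p y × p ∉ qs × p ≢ r × p ≢ neg r
avail₂± a y y≢-a qs {qs′} qs′≤ sub r = case Pos? r y of λ where
    (yes ry) → case avail₂ y a y≢-a (r ∷ qs′) (s≤s (s≤s qs′≤)) of λ where
      (p , py , pa , p∉) → p , pa , py , p∉ ∘ there ∘ sub py , p∉ ∘ here , λ { refl →
        Pos-neg (Pos-sym py) (Pos-sym (subst (λ z → Pos z y) (sym (∙-involutive Sign.- r)) ry)) }
    (no ¬ry) → case avail₂ y a y≢-a (neg r ∷ qs′) (s≤s (s≤s qs′≤)) of λ where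
      (p , py , pa , p∉) →
        p , pa , py , p∉ ∘ there ∘ sub py , (λ { refl → ¬ry py }) , p∉ ∘ here

-- `r` comes after `bad`, as it will be a new color not yet known. If `y` is not `neg a`, there are
-- four common neighbors of `a` and `y`; `r` and `neg r` together cost one of them, so two colors of
-- `qs` adjacent to `y` are affordable. Three distinct ones are all adjacent to `y` only if `y` is
-- among their at most two common neighbors.
extend± : ∀ a qs → length qs ≤ 3 → ∃ λ bad → length bad ≤ 3 ×
  (∀ {y} → y ∉ bad → ∀ r → ∃ λ p → Pos p a × Pos p y × p ∉ qs × p ≢ r × p ≢ neg r)
extend± a qs qs≤ = go qs qs≤
  where
  open Remove _≟ᶜ_ using (_∖_; ∈-∖⁺; length-∖-<)

  Result : List Color → Set
  Result qs = ∃ λ bad → length bad ≤ 3 ×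
    (∀ {y} → y ∉ bad → ∀ r → ∃ λ p → Pos p a × Pos p y × p ∉ qs × p ≢ r × p ≢ neg r)

  short : ∀ qs qs′ → length qs′ ≤ 2 → (∀ {p} → p ∈ qs → p ∈ qs′) → Result qs
  short qs qs′ qs′≤ sub = neg a ∷ [] , s≤s z≤n , λ {y} y∉ →
    avail₂± a y (y∉ ∘ here) qs qs′≤ (λ _ → sub)

  go : ∀ qs → length qs ≤ 3 → Result qs
  go []           _ = short [] [] z≤n λ ()
  go (q ∷ [])     _ = short (q ∷ []) (q ∷ []) (s≤s z≤n) λ x → x
  go (q ∷ r ∷ []) _ = short (q ∷ r ∷ []) (q ∷ r ∷ []) (s≤s (s≤s z≤n)) λ x → x
  go qs@(q ∷ r ∷ s ∷ []) _ = case (q ≟ᶜ r) of λ where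
    (yes refl) → short qs (q ∷ s ∷ []) ℕ.≤-refl λ where
      (here e) → here e ; (there (here e)) → here e ; (there (there x)) → there x
    (no q≢r) → case (q ≟ᶜ s) of λ where
      (yes refl) → short qs (q ∷ r ∷ []) ℕ.≤-refl λ where
        (here e) → here e ; (there (here e)) → there (here e) ; (there (there (here e))) → here e
      (no q≢s) → case (r ≟ᶜ s) of λ where
        (yes refl) → short qs (q ∷ r ∷ []) ℕ.≤-refl λ where
          (here e) → here e ; (there (here e)) → there (here e) ; (there (there (here e))) → there (here e)
        (no r≢s) → neg a ∷ common qs , s≤s (length-common₃ q r s q≢r q≢s r≢s) , λ {y} y∉ →
          let t , t∈ , ¬yt = find (¬All⇒Any¬ (Pos? y) qs (y∉ ∘ there ∘ ∈-common⁺))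
          in  avail₂± a y (y∉ ∘ here) qs {qs ∖ t} (ℕ.≤-pred (length-∖-< t∈))
                (λ py p∈ → ∈-∖⁺ p∈ λ { refl → ¬yt (Pos-sym py) })
  go (_ ∷ _ ∷ _ ∷ _ ∷ _) (s≤s (s≤s (s≤s ())))

extendᵦ : ∀ as → length as ≤ 1 → ∀ qs → length qs ≤ 3 → ∃ λ bad → length bad ≤ 3 ×
  (∀ {y} → y ∉ bad → ∀ r → ∃ λ p → Pos p y × All (Pos p) as × p ∉ qs × p ≢ r × p ≢ neg r)
extendᵦ [] _ qs qs≤ = [] , z≤n , λ {y} _ r →
  let p , py , p∉ = avail₁ y (r ∷ neg r ∷ qs) (s≤s (s≤s (s≤s (ℕ.≤-trans qs≤ (ℕ.m≤m+n 3 3)))))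
  in  p , py , [] , p∉ ∘ there ∘ there , p∉ ∘ here , p∉ ∘ there ∘ here
extendᵦ (a ∷ []) _ qs qs≤ =
  let bad , bad≤ , f = extend± a qs qs≤
  in  bad , bad≤ , λ y∉ r →
        let p , pa , py , p∉ , p≢r , p≢-r = f y∉ r in p , py , pa ∷ [] , p∉ , p≢r , p≢-r
extendᵦ (_ ∷ _ ∷ _) (s≤s ()) _ _

-- One of the four forbidden colors takes the place of `r` in `extendᵦ`.
extendᵧ : ∀ as → length as ≤ 1 → ∀ qs → length qs ≤ 4 →
  ∃ λ bad → length bad ≤ 3 × (∀ {y} → y ∉ bad → ∃ λ p → Pos p y × All (Pos p) as × p ∉ qs)
extendᵧ as as≤ [] _ =
  let bad , bad≤ , f = extendᵦ as as≤ [] z≤n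
  in  bad , bad≤ , λ {y} y∉ → let p , py , ps , p∉ , _ = f y∉ y in p , py , ps , p∉
extendᵧ as as≤ (q ∷ qs) (s≤s qs≤) =
  let bad , bad≤ , f = extendᵦ as as≤ qs qs≤
  in  bad , bad≤ , λ y∉ → let p , py , ps , p∉ , p≢q , _ = f y∉ q in
        p , py , ps , λ { (here p≡q) → p≢q p≡q ; (there p∈) → p∉ p∈ }

Pos⇒≢ : ∀ {p q} → Pos p q → proj₁ p ≢ proj₁ q
Pos⇒≢ {x , _} ⟨ h ⟩ refl = diagonal x h
  where
  diagonal : ∀ x {s} → ¬ T (isJust (entry x x) s)
  diagonal x {s} h = subst (λ m → T (isJust m s)) (entry-diagonal x) h
    where
    entry-diagonal : ∀ x → entry x x ≡ nothing
    entry-diagonal = from-yes (Fin.all? λ x → Maybe.≡-dec Sign._≟_ (entry x x) nothing)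

∙-move : ∀ s {p q} → s ∙ p ≡ q → p ≡ s ∙ q
∙-move s {p} eq = trans (sym (∙-involutive s p)) (cong (s ∙_) eq)

∙-neg-swap : ∀ s t {p q} → q ≡ neg (s ∙ t ∙ p) → p ≡ neg (t ∙ s ∙ q)
∙-neg-swap s t {p} {q} eq = trans
  (∙-move t (∙-move s (∙-move Sign.- (sym eq))))
  (trans (cong (t ∙_) (∙-comm s Sign.- q)) (∙-comm t Sign.- (s ∙ q)))

∙-neg-≡ : ∀ s t {p q} → s ∙ p ≡ neg (t ∙ q) → p ≡ neg (s ∙ t ∙ q)
∙-neg-≡ s t {p} {q} eq = trans (∙-move s eq) (∙-comm s Sign.- (t ∙ q))

extend-single : ∀ as → length as ≤ 1 → ∃ λ a → ∀ {p} → Pos p a → All (Pos p) as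
extend-single [] _ = (zero , Sign.+) , λ _ → []
extend-single (a ∷ []) _ = a , λ pa → pa ∷ []
extend-single (_ ∷ _ ∷ _) (s≤s ())

-- `p₂` is chosen first, so that `s ∙ p₂` is none of the three exceptions of `extend₃` for `a₁` and
-- `s₁ ∙ y`. Two of these and the color in `qs₂` are avoided among four candidates. The third,
-- `neg (s₁ ∙ y)`, is excluded for free: `p₂` is adjacent to `s₂ ∙ y`, hence lies over another
-- vertex of `SP₉ ⁺`.
extend-pair : ∀ s s₁ s₂ as₁ as₂ → length as₁ ≤ 1 → length as₂ ≤ 1 →
  ∀ qs₁ qs₂ → length qs₁ ≤ 1 → length qs₂ ≤ 1 →
  ∃ λ bad → length bad ≤ 2 × (∀ {y} → y ∉ bad → ∃ λ p₁ → ∃ λ p₂ →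
    Pos p₁ (s ∙ p₂) ×
    (Pos p₁ (s₁ ∙ y) × All (Pos p₁) as₁ × p₁ ∉ qs₁) ×
    (Pos p₂ (s₂ ∙ y) × All (Pos p₂) as₂ × p₂ ∉ qs₂))
extend-pair s s₁ s₂ as₁ as₂ as₁≤ as₂≤ qs₁ qs₂ qs₁≤ qs₂≤
  with a₁ , f₁ ← extend-single as₁ as₁≤ | a₂ , f₂ ← extend-single as₂ as₂≤ =
  (s₁ ∙ neg a₁) ∷ (s₂ ∙ neg a₂) ∷ [] , ℕ.≤-refl , choose
  where
  neg-swap : ∀ {p q} → p ≡ neg q → q ≡ neg p
  neg-swap {p} {q} eq = trans (sym (∙-involutive Sign.- q)) (cong neg (sym eq))

  choose : ∀ {y} → y ∉ ((s₁ ∙ neg a₁) ∷ (s₂ ∙ neg a₂) ∷ []) → ∃ λ p₁ → ∃ λ p₂ →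
    Pos p₁ (s ∙ p₂) ×
    (Pos p₁ (s₁ ∙ y) × All (Pos p₁) as₁ × p₁ ∉ qs₁) ×
    (Pos p₂ (s₂ ∙ y) × All (Pos p₂) as₂ × p₂ ∉ qs₂)
  choose {y} y∉ =
    case extend₃ a₁ (s₁ ∙ y) (y∉ ∘ here ∘ ∙-move s₁ ∘ neg-swap) qs₁ qs₁≤ of λ where
      (x , f) → case avail₂ a₂ (s₂ ∙ y) (y∉ ∘ there ∘ here ∘ ∙-move s₂ ∘ neg-swap)
                       ((s ∙ neg a₁) ∷ (s ∙ x) ∷ qs₂) (s≤s (s≤s (s≤s qs₂≤))) of λ where
        (p₂ , p₂a₂ , p₂y , p₂∉) →
          case f {s ∙ p₂} (p₂∉ ∘ here ∘ ∙-move s) (Pos⇒≢ p₂y ∘ cong proj₁)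
                 (p₂∉ ∘ there ∘ here ∘ ∙-move s) of λ where
            (p₁ , p₁a₁ , p₁y , p₁p₂ , p₁∉) →
              p₁ , p₂ , p₁p₂ , (p₁y , f₁ p₁a₁ , p₁∉) , (p₂y , f₂ p₂a₂ , p₂∉ ∘ there ∘ there)

-- Finite sums

private
  +-interchange : ∀ a b c d → (a + b) + (c + d) ≡ (a + c) + (b + d)
  +-interchange = solve-∀

  +-swap : ∀ a b c → a + (b + c) ≡ b + (a + c)
  +-swap = solve-∀

∑ : {A : Set} → List A → (A → ℕ) → ℕ
∑ xs f = sum (map f xs)

module _ {A : Set} where

  ∑-mono : ∀ xs {f g : A → ℕ} → (∀ {x} → x ∈ xs → f x ≤ g x) → ∑ xs f ≤ ∑ xs g
  ∑-mono [] _ = z≤n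
  ∑-mono (x ∷ xs) h = ℕ.+-mono-≤ (h (here refl)) (∑-mono xs (h ∘ there))

  ∑-mono-< : ∀ {xs} {f g : A → ℕ} → (∀ x → f x ≤ g x) → ∀ {x} → x ∈ xs → f x < g x → ∑ xs f < ∑ xs g
  ∑-mono-< {_ ∷ xs} f≤g (here refl) f<g = ℕ.+-mono-<-≤ f<g (∑-mono xs λ _ → f≤g _)
  ∑-mono-< {y ∷ _}  f≤g (there x∈)  f<g = ℕ.+-mono-≤-< (f≤g y) (∑-mono-< f≤g x∈ f<g)

  ∑-const : ∀ (xs : List A) k → ∑ xs (λ _ → k) ≡ length xs * k
  ∑-const [] k = refl
  ∑-const (_ ∷ xs) k = cong (k +_) (∑-const xs k)

  ∑-≤ : ∀ xs {f : A → ℕ} k → (∀ {x} → x ∈ xs → f x ≤ k) → ∑ xs f ≤ length xs * k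
  ∑-≤ xs k h = subst (_ ≤_) (∑-const xs k) (∑-mono xs h)

  ∑-≥ : ∀ xs {f : A → ℕ} k → (∀ {x} → x ∈ xs → k ≤ f x) → length xs * k ≤ ∑ xs f
  ∑-≥ xs k h = subst (_≤ _) (∑-const xs k) (∑-mono xs h)

  ∑-≥-one : ∀ {xs} {f : A → ℕ} {x} → x ∈ xs → f x ≤ ∑ xs f
  ∑-≥-one (here refl) = ℕ.m≤m+n _ _
  ∑-≥-one {_ ∷ xs} {f} (there x∈) = ℕ.≤-trans (∑-≥-one x∈) (ℕ.m≤n+m _ _)

  ∑-+ : ∀ xs (f g : A → ℕ) → ∑ xs (λ x → f x + g x) ≡ ∑ xs f + ∑ xs g
  ∑-+ [] f g = refl
  ∑-+ (x ∷ xs) f g = trans (cong (f x + g x +_) (∑-+ xs f g)) (+-interchange (f x) (g x) _ _)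

  ∑-* : ∀ xs k (f : A → ℕ) → ∑ xs (λ x → k * f x) ≡ k * ∑ xs f
  ∑-* [] k f = sym (ℕ.*-zeroʳ k)
  ∑-* (x ∷ xs) k f = trans (cong (k * f x +_) (∑-* xs k f)) (sym (ℕ.*-distribˡ-+ k (f x) _))

  module _ {P : A → Set} (P? : ∀ x → Dec (P x)) where

    ∑-split : ∀ xs f → ∑ xs f ≡ ∑ (filter (λ x → ¬? (P? x)) xs) f + ∑ (filter P? xs) f
    ∑-split [] f = refl
    ∑-split (x ∷ xs) f with P? x
    ... | yes _ = trans (cong (f x +_) (∑-split xs f)) (+-swap (f x) (∑ (filter (λ x → ¬? (P? x)) xs) f) _)
    ... | no _ = trans (cong (f x +_) (∑-split xs f)) (sym (ℕ.+-assoc (f x) _ _))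

    ∑-filter : ∀ xs f → (∀ {x} → ¬ P x → f x ≡ 0) → ∑ xs f ≡ ∑ (filter P? xs) f
    ∑-filter xs f h = trans (∑-split xs f) (cong (_+ ∑ (filter P? xs) f) outside)
      where
      others : List A
      others = filter (λ x → ¬? (P? x)) xs
      outside : ∑ others f ≡ 0
      outside = ℕ.n≤0⇒n≡0 (subst (∑ others f ≤_) (ℕ.*-zeroʳ (length others))
        (∑-≤ others 0 λ x∈ → ℕ.≤-reflexive (h (proj₂ (∈-filter⁻ (λ x → ¬? (P? x)) {xs = xs} x∈)))))

∑-comm : ∀ {A B : Set} (xs : List A) (ys : List B) (f : A → B → ℕ) →
         ∑ xs (λ x → ∑ ys (f x)) ≡ ∑ ys (λ y → ∑ xs (λ x → f x y))
∑-comm [] ys f = sym (trans (∑-const ys 0) (ℕ.*-zeroʳ (length ys)))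
∑-comm (x ∷ xs) ys f = trans (cong (∑ ys (f x) +_) (∑-comm xs ys f)) (sym (∑-+ ys (f x) _))

indicator : {A : Set} → Dec A → ℕ
indicator (yes _) = 1
indicator (no _)  = 0

indicator-0 : ∀ {A : Set} (a? : Dec A) → ¬ A → indicator a? ≡ 0
indicator-0 (no _)  _  = refl
indicator-0 (yes a) ¬a = contradiction a ¬a

indicator-≤ : ∀ {A B : Set} (a? : Dec A) (b? : Dec B) → (A → B) → indicator a? ≤ indicator b?
indicator-≤ (no _)  _       _ = z≤n
indicator-≤ (yes _) (yes _) _ = ℕ.≤-refl
indicator-≤ (yes a) (no ¬b) f = contradiction (f a) ¬b

indicator-< : ∀ {A B : Set} (a? : Dec A) (b? : Dec B) → ¬ A → B → indicator a? < indicator b?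
indicator-< (no _)  (yes _) _  _ = ℕ.≤-refl
indicator-< (yes a) _       ¬a _ = contradiction a ¬a
indicator-< _       (no ¬b) _  b = contradiction b ¬b

∑-indicator : ∀ {A : Set} {P : A → Set} (P? : ∀ x → Dec (P x)) xs →
              ∑ xs (λ x → indicator (P? x)) ≡ length (filter P? xs)
∑-indicator P? [] = refl
∑-indicator P? (x ∷ xs) with P? x
... | yes _ = cong suc (∑-indicator P? xs)
... | no _  = ∑-indicator P? xs

-- Colorings of signed graphs

module _ {n : ℕ} where

  Coloring : Set
  Coloring = Fin n → Color

  _[_≔_] : Coloring → Fin n → Color → Coloring
  c [ v ≔ p ] = updateAt c v λ _ → p

  update-≡ : ∀ c v {p} → (c [ v ≔ p ]) v ≡ p
  update-≡ c v = updateAt-updates v c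

  update-≢ : ∀ c {v x p} → x ≢ v → (c [ v ≔ p ]) x ≡ c x
  update-≢ c {v} {x} x≢v = updateAt-minimal x v c x≢v

module Graph {n : ℕ} (G : SignedGraph n) where

  open Remove (Fin._≟_ {n}) hiding (fresh)

  Adj : Fin n → Fin n → Set
  Adj x y = adj G x y ≢ nothing

  adj? : ∀ x y → Dec (Adj x y)
  adj? x y = ¬? (Maybe.≡-dec Sign._≟_ (adj G x y) nothing)

  edge : Fin n → Fin n → ℕ
  edge x y = indicator (adj? x y)

  Adj-sym : ∀ {x y} → Adj x y → Adj y x
  Adj-sym {x} {y} a e = a (trans (adj-sym G x y) e)

  Adj⇒≢ : ∀ {x y} → Adj x y → x ≢ y
  Adj⇒≢ {x} a refl = a (adj-irrefl G x)

  sg : Fin n → Fin n → Sign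
  sg x y = fromMaybe Sign.+ (adj G x y)

  sg-sym : ∀ x y → sg x y ≡ sg y x
  sg-sym x y = cong (fromMaybe Sign.+) (adj-sym G x y)

  N : Fin n → List (Fin n)
  N x = filter (adj? x) (allFin n)

  ∈-N⁺ : ∀ {x y} → Adj x y → y ∈ N x
  ∈-N⁺ {x} {y} = ∈-filter⁺ (adj? x) (∈-allFin y)

  ∈-N⁻ : ∀ {x y} → y ∈ N x → Adj x y
  ∈-N⁻ {x} y∈ = proj₂ (∈-filter⁻ (adj? x) {xs = allFin n} y∈)

  N-unique : ∀ x → Unique (N x)
  N-unique x = Unique.filter⁺ (adj? x) (Unique.allFin⁺ n)

  deg : Fin n → ℕ
  deg x = length (N x)

  Light : Fin n → Set
  Light x = deg x ≤ 2

  light? : ∀ x → Dec (Light x)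
  light? x = deg x ℕ.≤? 2

  strong : Fin n → List (Fin n)
  strong x = filter (λ y → ¬? (light? y)) (N x)

  light : Fin n → List (Fin n)
  light x = filter light? (N x)

  ∈-strong⁺ : ∀ {x y} → Adj x y → ¬ Light y → y ∈ strong x
  ∈-strong⁺ a = ∈-filter⁺ (λ y → ¬? (light? y)) (∈-N⁺ a)

  ∈-strong⁻ : ∀ {x y} → y ∈ strong x → Adj x y × ¬ Light y
  ∈-strong⁻ {x} y∈ = let y∈N , ¬l = ∈-filter⁻ (λ y → ¬? (light? y)) {xs = N x} y∈ in ∈-N⁻ y∈N , ¬l

  ∈-light⁺ : ∀ {x y} → Adj x y → Light y → y ∈ light x
  ∈-light⁺ a = ∈-filter⁺ light? (∈-N⁺ a)

  ∈-light⁻ : ∀ {x y} → y ∈ light x → Adj x y × Light y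
  ∈-light⁻ {x} y∈ = let y∈N , l = ∈-filter⁻ light? {xs = N x} y∈ in ∈-N⁻ y∈N , l

  strong-unique : ∀ x → Unique (strong x)
  strong-unique x = Unique.filter⁺ (λ y → ¬? (light? y)) (N-unique x)

  -- The color of `x` is a separate argument, so that a candidate can be tested before `c` is
  -- updated.
  Fit : Coloring → Fin n → Fin n → Color → Set
  Fit c x y p = Adj x y → Pos p (sg x y ∙ c y)

  Proper : Coloring → Set
  Proper c = ∀ x y → Fit c x y (c x)

  ProperExcept : Fin n → List (Fin n) → Coloring → Set
  ProperExcept w D c = ∀ x y → ¬ (x ≡ w × y ∈ D) → ¬ (y ≡ w × x ∈ D) → Fit c x y (c x)

  fit-sym : ∀ c {x y} → Adj y x → Fit c x y (c x) → Pos (c y) (sg y x ∙ c x)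
  fit-sym c {x} {y} a f = Pos-sym (Pos-∙⁻ (sg y x)
    (subst (λ s → Pos (c x) (s ∙ c y)) (sg-sym x y) (f (Adj-sym a))))

  recolor : ∀ c {v p} → (∀ x y → x ≢ v → y ≢ v → Fit c x y (c x)) → (∀ x → Fit c v x p) →
             Proper (c [ v ≔ p ])
  recolor c {v} {p} off at x y a = case (x Fin.≟ v) of λ where
      (yes refl) → subst₂ (λ q r → Pos q (sg x y ∙ r)) (sym (update-≡ c v))
                     (sym (update-≢ c (≢-sym (Adj⇒≢ a)))) (at y a)
      (no x≢v) → case (y Fin.≟ v) of λ where
        (yes refl) → fit-sym (c [ v ≔ p ]) a λ a′ →
          subst₂ (λ q r → Pos q (sg y x ∙ r)) (sym (update-≡ c v)) (sym (update-≢ c x≢v)) (at x a′)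
        (no y≢v) → subst₂ (λ q r → Pos q (sg x y ∙ r)) (sym (update-≢ c x≢v)) (sym (update-≢ c y≢v))
          (off x y x≢v y≢v a)

  -- At most two signed colors are seen from `l`, and non-antipodal colors have common neighbors.
  light-color : ∀ c {l} → Light l →
    (∀ {y z} → Adj l y → Adj l z → y ≢ z → sg l y ∙ c y ≢ neg (sg l z ∙ c z)) →
    ∃ λ p → ∀ x → Fit c l x p
  light-color c {l} l≤2 compatible =
      let p , ps = choose (N l) l≤2 (N-unique l) ∈-N⁻
      in  p , λ x a → All.lookup ps (∈-map⁺ (λ x → sg l x ∙ c x) (∈-N⁺ a))
    where
    choose : ∀ xs → length xs ≤ 2 → Unique xs → (∀ {x} → x ∈ xs → Adj l x) →
             ∃ λ p → All (Pos p) (map (λ x → sg l x ∙ c x) xs)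
    choose [] _ _ _ = c l , []
    choose (x ∷ []) _ _ _ = let p , px , _ = avail₁ (sg l x ∙ c x) [] (s≤s z≤n) in p , px ∷ []
    choose (x ∷ y ∷ []) _ ((x≢y ∷ []) ∷ _) adj-l =
      let p , px , py , _ = avail₂ _ _ (compatible (adj-l (here refl)) (adj-l (there (here refl))) x≢y)
                              [] (s≤s z≤n)
      in  p , px ∷ py ∷ []
    choose (_ ∷ _ ∷ _ ∷ _) (s≤s (s≤s ())) _ _

  -- A light vertex l with neighbors v and z can be colored unless v has this color.
  forb : Coloring → Fin n → Fin n → Fin n → Color
  forb c v l z = neg (sg l v ∙ sg l z ∙ c z)

  record Compatible (c : Coloring) (v z : Fin n) (p : Color) : Set where
    field
      fit  : Fit c v z p
      path : ∀ {l} → Light l → Adj l v → Adj l z → p ≢ forb c v l z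
  open Compatible public

  compatible-sym : ∀ c {v z} → Compatible c v z (c v) → Compatible c z v (c z)
  compatible-sym c k .fit a = fit-sym c a (k .fit)
  compatible-sym c {v} {z} k .path {l} l-light lz lv eq =
    k .path l-light lv lz (∙-neg-swap (sg l z) (sg l v) eq)

  Fits : Coloring → List (Fin n) → Fin n → Color → Set
  Fits c X v p = ∀ z → ¬ Light z → z ≢ v → z ∉ X → Compatible c v z p

  Avoids : Coloring → Fin n → Color → Set
  Avoids c v p = ∀ {l z} → Light l → Adj l v → Adj l z → z ≢ v → p ≢ forb c v l z

  fits : ∀ {c X v p} → (∀ z → ¬ Light z → z ∉ X → Fit c v z p) → Avoids c v p → Fits c X v p
  fits edges avoids z ¬lz z≢v z∉X = record
    { fit = edges z ¬lz z∉X
    ; path = λ l-light lv lz → avoids l-light lv lz z≢v }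

  -- The vertices outside X are colored so that all light vertices between them can be colored.
  Extendable : Coloring → List (Fin n) → Set
  Extendable c X = ∀ v z → ¬ Light v → ¬ Light z → v ≢ z → v ∉ X → z ∉ X → Compatible c v z (c v)

  -- Only pairs containing `v` are affected, and by `compatible-sym` it is enough to treat them with
  -- `v` in first place.
  step : ∀ {c X v p} → Extendable c (v ∷ X) → Fits c X v p → Extendable (c [ v ≔ p ]) X
  step {c} {X} {v} {p} ext fits-v x z ¬lx ¬lz x≢z x∉X z∉X =
    case (x Fin.≟ v) of λ where
      (yes refl) → at-v z ¬lz (≢-sym x≢z) z∉X
      (no x≢v) → case (z Fin.≟ v) of λ where
        (yes refl) → compatible-sym (c [ v ≔ p ]) (at-v x ¬lx x≢z x∉X)
        (no z≢v) → transport (update-≢ c x≢v) (update-≢ c z≢v)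
          (ext x z ¬lx ¬lz x≢z (λ { (here e) → x≢v e ; (there x∈) → x∉X x∈ })
                               (λ { (here e) → z≢v e ; (there z∈) → z∉X z∈ }))
    where
    transport : ∀ {c c′ x z p p′} → p′ ≡ p → c′ z ≡ c z → Compatible c x z p → Compatible c′ x z p′
    transport {x = x} {z} {p} refl eq k .fit a = subst (λ q → Pos p (sg x z ∙ q)) (sym eq) (k .fit a)
    transport {x = x} {z} refl eq k .path {l} l-light lx lz e =
      k .path l-light lx lz (trans e (cong (λ q → neg (sg l x ∙ sg l z ∙ q)) eq))
    at-v : ∀ z → ¬ Light z → z ≢ v → z ∉ X → Compatible (c [ v ≔ p ]) v z ((c [ v ≔ p ]) v)
    at-v z ¬lz z≢v z∉X = transport (update-≡ c v) (update-≢ c z≢v) (fits-v z ¬lz z≢v z∉X)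

  weaken : ∀ {c X Y} → (∀ {x} → x ∈ X → x ∈ Y) → Extendable c X → Extendable c Y
  weaken X⊆Y ext x z ¬lx ¬lz x≢z x∉Y z∉Y =
    ext x z ¬lx ¬lz x≢z (x∉Y ∘ X⊆Y) (z∉Y ∘ X⊆Y)

  pathsVia : Fin n → List (Fin n) → List (Fin n × Fin n)
  pathsVia v = concatMap λ l → map (l ,_) (N l ∖ v)

  paths : Fin n → List (Fin n × Fin n)
  paths v = pathsVia v (light v)

  ∈-paths : ∀ {v l z} → Light l → Adj l v → Adj l z → z ≢ v → (l , z) ∈ paths v
  ∈-paths {v} {l} {z} l-light lv lz z≢v =
    ∈-concatMap⁺ (λ l → map (l ,_) (N l ∖ v))
      (lose (∈-light⁺ (Adj-sym lv) l-light) (∈-map⁺ (l ,_) (∈-∖⁺ (∈-N⁺ lz) z≢v)))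

  -- Each light neighbor of `v` has at most one neighbor besides `v`.
  length-paths : ∀ v → length (paths v) ≤ length (light v)
  length-paths v = via (light v) ∈-light⁻
    where
    via : ∀ ls → (∀ {l} → l ∈ ls → Adj v l × Light l) → length (pathsVia v ls) ≤ length ls
    via [] _ = z≤n
    via (l ∷ ls) h =
      let vl , l-light = h (here refl) in
      subst (_≤ suc (length ls)) (sym (trans
        (List.length-++ (map (l ,_) (N l ∖ v)))
        (cong (_+ length (pathsVia v ls)) (List.length-map (l ,_) (N l ∖ v)))))
      (ℕ.+-mono-≤ (ℕ.≤-pred (ℕ.<-≤-trans (length-∖-< (∈-N⁺ (Adj-sym vl))) l-light))
                  (via ls (h ∘ there)))

  forbs : Coloring → Fin n → List (Fin n × Fin n) → List Color
  forbs c v = map λ (l , z) → forb c v l z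

  length-forbs : ∀ c v → length (forbs c v (paths v)) ≤ length (light v)
  length-forbs c v = subst (_≤ length (light v)) (sym (List.length-map _ (paths v))) (length-paths v)

  avoids : ∀ {c v p} → p ∉ forbs c v (paths v) → Avoids c v p
  avoids {c} {v} p∉ {l} {z} l-light lv lz z≢v refl =
    p∉ (∈-map⁺ (λ (l , z) → forb c v l z) (∈-paths l-light lv lz z≢v))

  signed : Coloring → Fin n → List (Fin n) → List Color
  signed c v = map λ z → sg v z ∙ c z

  All-signed : ∀ {c v p} zs → (∀ {z} → z ∈ zs → Pos p (sg v z ∙ c z)) → All (Pos p) (signed c v zs)
  All-signed [] _ = []
  All-signed (z ∷ zs) h = h (here refl) ∷ All-signed zs (h ∘ there)

  signed-lookup : ∀ {c v p zs z} → All (Pos p) (signed c v zs) → z ∈ zs → Pos p (sg v z ∙ c z)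
  signed-lookup {c} {v} ps z∈ = All.lookup ps (∈-map⁺ (λ z → sg v z ∙ c z) z∈)

-- Reducible configurations in a minimal counterexample

module Minimal {n : ℕ} (G : SignedGraph n)
  (¬colorable : ¬ ∃ (Graph.Proper G))
  (deletion : ∀ w D → Any (Graph.Adj G w) D → ∃ (Graph.ProperExcept G w D)) where

  open Graph G
  open Remove (Fin._≟_ {n}) hiding (fresh)

  -- Delete all edges at `l` and color the rest. Adjacent neighbors of `l` get colors over distinct
  -- vertices of `SP₉ ⁺`, so these are never antipodal and `l` could be colored.
  light-neighbors : ∀ {l x} → Light l → Adj l x →
                    ¬ (∀ {y z} → Adj l y → Adj l z → y ≢ z → Adj y z)
  light-neighbors {l} {x} l-light lx complete =
    case deletion l (N l) (lose (∈-N⁺ lx) lx) of λ where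
      (c , proper) →
        case light-color c l-light (λ {y} {z} ly lz y≢z eq →
               Pos⇒≢ (proper y z (λ (y≡l , _) → Adj⇒≢ ly (sym y≡l)) (λ (z≡l , _) → Adj⇒≢ lz (sym z≡l))
                        (complete ly lz y≢z))
                     (cong proj₁ eq)) of λ where
          (p , at) → ¬colorable (_ , recolor c
            (λ y z y≢l z≢l → proper y z (y≢l ∘ proj₁) (z≢l ∘ proj₁)) at)

  light-two : ∀ {l x} → Light l → Adj l x → ∃ λ y → Adj l y × y ≢ x
  light-two {l} {x} l-light lx = case Fin.any? (λ y → adj? l y ×-dec ¬? (y Fin.≟ x)) of λ where
      (yes found) → found
      (no none) → contradiction
        (λ {y} {z} ly lz y≢z → contradiction (trans (only none ly) (sym (only none lz))) y≢z)
        (light-neighbors l-light lx)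
    where
    only : ¬ (∃ λ y → Adj l y × y ≢ x) → ∀ {y} → Adj l y → y ≡ x
    only none {y} ly = case (y Fin.≟ x) of λ where
      (yes y≡x) → y≡x
      (no y≢x) → contradiction (y , ly , y≢x) none

  third-neighbor : ∀ {l x y z} → Light l → Adj l x → Adj l y → Adj l z →
                   x ≢ y → x ≢ z → y ≢ z → ⊥
  third-neighbor {l} {x} {y} {z} l-light lx ly lz x≢y x≢z y≢z =
    ℕ.<⇒≱ (s≤s (ℕ.≤-trans (s≤s (length-∖-pos (∈-∖⁺ (∈-∖⁺ (∈-N⁺ lz) (≢-sym x≢z)) (≢-sym y≢z))))
                 (length-∖-< (∈-∖⁺ (∈-N⁺ ly) (≢-sym x≢y)))))
           (ℕ.≤-trans (length-∖-< (∈-N⁺ lx)) l-light)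
    where
    length-∖-pos : ∀ {A : Set} {x : A} {xs} → x ∈ xs → 1 ≤ length xs
    length-∖-pos (here _)  = s≤s z≤n
    length-∖-pos (there _) = s≤s z≤n

  no-triangle : ∀ {l u w} → Light l → Adj l u → Adj l w → ¬ Adj u w
  no-triangle {l} {u} {w} l-light lu lw uw = light-neighbors l-light lu λ {y} {z} ly lz y≢z →
    case (y Fin.≟ u) of λ where
      (yes refl) → case (z Fin.≟ w) of λ where
        (yes refl) → uw
        (no z≢w) → contradiction (≢-sym z≢w) (third-neighbor l-light ly lw lz (Adj⇒≢ uw) y≢z)
      (no y≢u) → case (y Fin.≟ w) of λ where
        (no y≢w) → contradiction (≢-sym y≢w) (third-neighbor l-light lu lw ly (Adj⇒≢ uw) (≢-sym y≢u))
        (yes refl) → case (z Fin.≟ u) of λ where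
          (yes refl) → Adj-sym uw
          (no z≢u) → contradiction y≢z (third-neighbor l-light lu lw lz (Adj⇒≢ uw) (≢-sym z≢u))

  -- With `ll′` deleted, `l′` has at most one constraint, hence at least nine colors, and only one
  -- of them can clash with the other neighbor of `l`. So `l′` is recolored first and then `l`.
  light-independent : ∀ {l l′} → Light l → Light l′ → ¬ Adj l l′
  light-independent {l} {l′} l-light l′-light ll′ =
    case deletion l′ (l ∷ []) (here (Adj-sym ll′)) of λ where
      (c , proper) →
        case avail (signed c l′ (N l′ ∖ l)) {c l′}
               (All-signed (N l′ ∖ l) λ {z} z∈ → let z∈N , z≢l = ∈-∖⁻ z∈ in
                 proper l′ z (λ { (_ , here z≡l) → z≢l z≡l }) (Adj⇒≢ (∈-N⁻ z∈N) ∘ sym ∘ proj₁) (∈-N⁻ z∈N))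
               (forbidden c) (bound c) of λ where
          (p , ps , p∉) → case light-color (c [ l′ ≔ p ]) l-light (nonclashing c p p∉) of λ where
            (q , at) → ¬colorable (_ , recolor (c [ l′ ≔ p ]) (off c proper p ps) at)
    where
    forbidden : Coloring → List Color
    forbidden c = map (λ z → neg (sg l l′ ∙ sg l z ∙ c z)) (N l ∖ l′)

    one : ∀ {x y} → Light x → Adj x y → length (N x ∖ y) ≤ 1
    one x-light xy = ℕ.≤-pred (ℕ.<-≤-trans (length-∖-< (∈-N⁺ xy)) x-light)

    bound : ∀ c → length (forbidden c) < available (length (signed c l′ (N l′ ∖ l)))
    bound c = ℕ.≤-trans
      (s≤s (subst (_≤ 1) (sym (List.length-map _ (N l ∖ l′))) (one l-light ll′)))
      (ℕ.≤-trans (ℕ.m≤n+m 2 7)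
        (available-anti (subst (_≤ 1) (sym (List.length-map _ (N l′ ∖ l))) (one l′-light (Adj-sym ll′)))))

    nonclashing : ∀ c p → p ∉ forbidden c → ∀ {y z} → Adj l y → Adj l z → y ≢ z →
      sg l y ∙ (c [ l′ ≔ p ]) y ≢ neg (sg l z ∙ (c [ l′ ≔ p ]) z)
    nonclashing c p p∉ {y} {z} ly lz y≢z eq = case (y Fin.≟ l′) of λ where
        (yes refl) → clash lz (≢-sym y≢z) eq
        (no y≢l′) → case (z Fin.≟ l′) of λ where
          (yes refl) → clash ly y≢z (trans (sym (∙-involutive Sign.- _)) (cong neg (sym eq)))
          (no z≢l′) → third-neighbor l-light ll′ ly lz (≢-sym y≢l′) (≢-sym z≢l′) y≢z
      where
      clash : ∀ {z} → Adj l z → z ≢ l′ → sg l l′ ∙ (c [ l′ ≔ p ]) l′ ≢ neg (sg l z ∙ (c [ l′ ≔ p ]) z)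
      clash {z} lz z≢l′ eq = p∉ (subst (_∈ forbidden c)
        (sym (∙-neg-≡ (sg l l′) (sg l z) (subst₂ (λ p q → sg l l′ ∙ p ≡ neg (sg l z ∙ q))
                                   (update-≡ c l′) (update-≢ c z≢l′) eq)))
        (∈-map⁺ (λ z → neg (sg l l′ ∙ sg l z ∙ c z)) (∈-∖⁺ (∈-N⁺ lz) z≢l′)))

    off : ∀ c → ProperExcept l′ (l ∷ []) c → ∀ p → All (Pos p) (signed c l′ (N l′ ∖ l)) →
      ∀ x y → x ≢ l → y ≢ l → Fit (c [ l′ ≔ p ]) x y ((c [ l′ ≔ p ]) x)
    off c proper p ps x y x≢l y≢l xy = case (x Fin.≟ l′) of λ where
        (yes refl) → at y y≢l xy
        (no x≢l′) → case (y Fin.≟ l′) of λ where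
          (yes refl) → fit-sym (c [ l′ ≔ p ]) xy (at x x≢l)
          (no y≢l′) → subst₂ (λ q r → Pos q (sg x y ∙ r)) (sym (update-≢ c x≢l′)) (sym (update-≢ c y≢l′))
            (proper x y (x≢l′ ∘ proj₁) (y≢l′ ∘ proj₁) xy)
      where
      at : ∀ y → y ≢ l → Fit (c [ l′ ≔ p ]) l′ y ((c [ l′ ≔ p ]) l′)
      at y y≢l l′y = subst₂ (λ q r → Pos q (sg l′ y ∙ r)) (sym (update-≡ c l′))
        (sym (update-≢ c (≢-sym (Adj⇒≢ l′y)))) (signed-lookup ps (∈-∖⁺ (∈-N⁺ l′y) y≢l))

  -- The light vertices are colored last and independently of each other, no two being adjacent;
  -- `path` excludes antipodal colors at their neighbors.
  ¬extendable : ∀ c → ¬ Extendable c []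
  ¬extendable c ext = ¬colorable (c′ , proper)
    where
    at-light : ∀ l → Light l → ∃ λ p → ∀ x → Fit c l x p
    at-light l l-light = light-color c l-light λ {y} {z} ly lz y≢z eq →
      path (ext y z (λ h → light-independent l-light h ly) (λ h → light-independent l-light h lz)
                y≢z (λ ()) (λ ()))
           l-light ly lz (∙-neg-≡ (sg l y) (sg l z) eq)

    c′ : Coloring
    c′ x = case light? x of λ where
      (yes x-light) → proj₁ (at-light x x-light)
      (no _) → c x

    c′-nonlight : ∀ {x} → ¬ Light x → c′ x ≡ c x
    c′-nonlight {x} ¬lx with light? x
    ... | yes lx = contradiction lx ¬lx
    ... | no _ = refl

    c′-light : ∀ {x} → Light x → ∀ y → Fit c x y (c′ x)
    c′-light {x} lx with light? x
    ... | yes l = proj₂ (at-light x l)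
    ... | no ¬lx = contradiction lx ¬lx

    half : ∀ {x y} → Light x → Fit c′ x y (c′ x)
    half {x} {y} lx xy = subst (λ q → Pos (c′ x) (sg x y ∙ q))
      (sym (c′-nonlight λ ly → light-independent lx ly xy)) (c′-light lx y xy)

    proper : Proper c′
    proper x y xy = case light? x of λ where
      (yes lx) → half lx xy
      (no ¬lx) → case light? y of λ where
        (yes ly) → fit-sym c′ xy (half ly)
        (no ¬ly) → subst₂ (λ p q → Pos p (sg x y ∙ q)) (sym (c′-nonlight ¬lx)) (sym (c′-nonlight ¬ly))
          (fit (ext x y ¬lx ¬ly (Adj⇒≢ xy) (λ ()) (λ ())) xy)

  -- A light `l` between two vertices other than `w` keeps both edges, so its present color is a
  -- common neighbor of their signed colors.
  extendable : ∀ {c w D} → ¬ Light w → ProperExcept w D c → Extendable c (w ∷ [])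
  extendable {c} {w} ¬lw proper v z _ _ _ v∉ z∉ = record
    { fit = proper v z (v∉ ∘ here ∘ proj₁) (z∉ ∘ here ∘ proj₁)
    ; path = λ {l} l-light lv lz eq →
        common-neighbor⇒≢neg (at l-light lv v∉) (at l-light lz z∉)
          (trans (cong (sg l v ∙_) eq) (trans (∙-comm (sg l v) Sign.- _) (cong neg (∙-involutive (sg l v) _)))) }
    where
    at : ∀ {l v} → Light l → Adj l v → v ∉ (w ∷ []) → Pos (c l) (sg l v ∙ c v)
    at {l} {v} l-light lv v∉ = proper l v (λ { (refl , _) → ¬lw l-light }) (v∉ ∘ here ∘ proj₁) lv

  -- Otherwise delete the edges from `w` to its light neighbors and recolor `w`: each of them
  -- forbids at most one color. A light neighbor `l` must exist for something to be deleted.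
  strong-neighbors-many : ∀ {w l} → ¬ Light w → l ∈ light w →
                          available (length (strong w)) ≤ length (light w)
  strong-neighbors-many {w} {l} ¬lw l∈ = ℕ.≮⇒≥ λ few →
    case deletion w (light w) (lose l∈ (proj₁ (∈-light⁻ l∈))) of λ where
      (c , proper) →
        case avail (signed c w (strong w)) {c w}
               (All-signed (strong w) λ {z} z∈ → let wz , ¬lz = ∈-strong⁻ z∈ in
                 proper w z (λ (_ , z∈) → ¬lz (proj₂ (∈-light⁻ z∈))) (Adj⇒≢ wz ∘ sym ∘ proj₁) wz)
               (forbs c w (paths w))
               (ℕ.≤-<-trans (length-forbs c w)
                 (subst (λ k → length (light w) < available k)
                   (sym (List.length-map _ (strong w))) few)) of λ where
          (p , ps , p∉) → ¬extendable _ (step (extendable ¬lw proper)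
            (fits (λ z ¬lz _ wz → signed-lookup ps (∈-strong⁺ wz ¬lz)) (avoids p∉)))

  -- Recoloring medium vertices

  FewStrong FewLight : Fin n → Set
  FewStrong u = length (strong u) ≤ 2 × length (light u) ≤ 4
  FewLight  u = length (strong u) ≤ 3 × length (light u) ≤ 1

  -- Such a vertex can be recolored as soon as a neighbor avoids three suitable colors.
  Medium : Fin n → Set
  Medium u = FewStrong u ⊎ FewLight u

  -- Conditions under which u can still be recolored after both w and e have been.
  record Exempt (w u e : Fin n) : Set where
    field
      distinct    : e ≢ u
      nonadjacent : Adj u e → e ≡ w
      unshared    : FewStrong u ⊎ (∀ {l} → Light l → Adj l u → ¬ Adj l e)

  -- With `e = w`, only `w` changes before `u` is recolored.
  exempt-self : ∀ {w u} → Adj u w → Exempt w u w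
  exempt-self uw = record
    { distinct = Adj⇒≢ (Adj-sym uw)
    ; nonadjacent = λ _ → refl
    ; unshared = inj₂ λ l-light lu lw → no-triangle l-light lu lw uw }

  private
    ∉-map-∙ : ∀ s {q bad} → q ∉ map (s ∙_) bad → s ∙ q ∉ bad
    ∉-map-∙ s {q} {bad} q∉ sq∈ =
      q∉ (subst (_∈ map (s ∙_) bad) (∙-involutive s q) (∈-map⁺ (s ∙_) sq∈))

    -- Whatever its signs, a light path from `u` to a vertex of color `r` forbids `r` or `neg r`;
    -- avoiding both handles all such paths at once.
    avoids-± : ∀ {p r} s t → p ≢ r → p ≢ neg r → p ≢ neg (s ∙ t ∙ r)
    avoids-± Sign.+ Sign.+ ≢r ≢-r = ≢-r
    avoids-± Sign.+ Sign.- ≢r ≢-r eq = ≢r (trans eq (∙-involutive Sign.- _))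
    avoids-± Sign.- Sign.+ ≢r ≢-r eq = ≢r (trans eq (∙-involutive Sign.- _))
    avoids-± Sign.- Sign.- ≢r ≢-r eq = ≢-r (trans eq (cong neg (∙-involutive Sign.- _)))

    length-forbs-≤ : ∀ c u {k} ps → length ps ≤ k → length (forbs c u ps) ≤ k
    length-forbs-≤ c u {k} ps = subst (_≤ k) (sym (List.length-map _ ps))

  module _ {u w e : Fin n} (uw : Adj u w) (ex : Exempt w u e)
           (c : Coloring) (at-u : ∀ z → z ≢ w → Fit c u z (c u)) where

    open Exempt ex

    Agree : Coloring → Set
    Agree c′ = ∀ z → z ≢ w → z ≢ e → c′ z ≡ c z

    -- `bad` depends on the old coloring only and must serve every later `c′`: the color of `w` is
    -- chosen to avoid it before the final `c′` is known.
    Recolorable : Set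
    Recolorable = ∃ λ bad → length bad ≤ 3 × (∀ c′ → Agree c′ →
      c′ w ∉ bad → ∃ λ p → Fits c′ [] u p)

    others : List (Fin n)
    others = strong u ∖ w

    at-others : All (Pos (c u)) (signed c u others)
    at-others = All-signed others λ z∈ → let z∈s , z≢w = ∈-∖⁻ z∈ in
      at-u _ z≢w (proj₁ (∈-strong⁻ z∈s))

    length-others : ∀ {k} → ¬ Light w → length (strong u) ≤ suc k → length (signed c u others) ≤ k
    length-others {k} ¬lw s≤ = subst (_≤ k) (sym (List.length-map _ others))
      (ℕ.≤-pred (ℕ.<-≤-trans (length-∖-< (∈-strong⁺ uw ¬lw)) s≤))

    fit-u : ∀ {c′ p} → Agree c′ →
      Pos p (sg u w ∙ c′ w) → All (Pos p) (signed c u others) →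
      ∀ z → ¬ Light z → z ∉ [] → Fit c′ u z p
    fit-u {c′} {p} agree pw ps z ¬lz _ uz = case z Fin.≟ w of λ where
      (yes refl) → pw
      (no z≢w) → subst (λ q → Pos p (sg u z ∙ q))
        (sym (agree z z≢w λ { refl → z≢w (nonadjacent uz) }))
        (signed-lookup ps (∈-∖⁺ (∈-strong⁺ uz ¬lz) z≢w))

    mate≢w : ∀ {l z} → Light l → Adj l u → Adj l z → z ≢ w
    mate≢w l-light lu lz refl = no-triangle l-light lu lz uw

    forb-agree : ∀ {c′ l z} → Agree c′ →
      Light l → Adj l u → Adj l z → z ≢ e → forb c′ u l z ≡ forb c u l z
    forb-agree {l = l} {z} agree l-light lu lz z≢e =
      cong (λ q → neg (sg l u ∙ sg l z ∙ q)) (agree z (mate≢w l-light lu lz) z≢e)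

    unshared-avoids : ∀ {c′ p} → Agree c′ →
      (∀ {l} → Light l → Adj l u → ¬ Adj l e) → p ∉ forbs c u (paths u) → Avoids c′ u p
    unshared-avoids agree not-e p∉ l-light lu lz z≢u eq =
      avoids p∉ l-light lu lz z≢u
        (trans eq (forb-agree agree l-light lu lz λ { refl → not-e l-light lu lz }))

    unshared-recolorable : (∀ {l} → Light l → Adj l u → ¬ Adj l e) →
      (∃ λ bad → length bad ≤ 3 × (∀ {y} → y ∉ bad →
        ∃ λ p → Pos p y × All (Pos p) (signed c u others) × p ∉ forbs c u (paths u))) →
      Recolorable
    unshared-recolorable not-e (bad , bad≤ , f) =
      map (sg u w ∙_) bad , subst (_≤ 3) (sym (List.length-map _ bad)) bad≤ , λ c′ agree y∉ →
      case f (∉-map-∙ (sg u w) y∉) of λ where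
        (p , py , ps , p∉) →
          p , fits (fit-u {c′} agree py ps) (unshared-avoids agree not-e p∉)

    few-light : ¬ Light w → FewLight u → (∀ {l} → Light l → Adj l u → ¬ Adj l e) → Recolorable
    few-light ¬lw (s≤ , l≤) not-e = unshared-recolorable not-e
      (extendₐ (signed c u others) at-others (length-others ¬lw s≤)
        (forbs c u (paths u)) (ℕ.≤-trans (length-forbs c u) l≤))

    -- Light paths from `u` to `e` depend on the new color of `e`. If there are any, at most three
    -- others remain, and `extendᵦ` takes that color as `r`. If there are none, all four forbidden
    -- colors are known from `c` and `extendᵧ` applies.
    few-strong : ¬ Light w → FewStrong u → Recolorable
    few-strong ¬lw (s≤ , l≤) = case Any.any? (λ lz → proj₂ lz Fin.≟ e) (paths u) of λ where
        (yes shared) → with-shared shared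
        (no none) → unshared-recolorable
          (λ l-light lu le → none (lose (∈-paths l-light lu le distinct) refl))
          (extendᵧ (signed c u others) (length-others ¬lw s≤)
            (forbs c u (paths u)) (ℕ.≤-trans (length-forbs c u) l≤))
      where
      unshared? : ∀ lz → Dec (proj₂ lz ≢ e)
      unshared? lz = ¬? (proj₂ lz Fin.≟ e)

      rest : List (Fin n × Fin n)
      rest = filter unshared? (paths u)

      with-shared : Any (λ lz → proj₂ lz ≡ e) (paths u) → Recolorable
      with-shared shared =
        case extendᵦ (signed c u others) (length-others ¬lw s≤) (forbs c u rest)
               (length-forbs-≤ c u rest (ℕ.≤-pred (ℕ.<-≤-trans
                 (List.filter-notAll unshared? (paths u) (Any.map (λ eq ≢ → ≢ eq) shared))
                 (ℕ.≤-trans (length-paths u) l≤)))) of λ where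
          (bad , bad≤ , f) →
            map (sg u w ∙_) bad , subst (_≤ 3) (sym (List.length-map _ bad)) bad≤ , λ c′ agree y∉ →
            case f (∉-map-∙ (sg u w) y∉) (c′ e) of λ where
              (p , py , ps , p∉ , p≢r , p≢-r) → p , fits (fit-u {c′} agree py ps)
                λ {l} {z} l-light lu lz z≢u → case z Fin.≟ e of λ where
                  (yes refl) → avoids-± (sg l u) (sg l z) p≢r p≢-r
                  (no z≢e) → λ eq → p∉ (subst (_∈ forbs c u rest)
                    (sym (trans eq (forb-agree agree l-light lu lz z≢e)))
                    (∈-map⁺ (λ (l , z) → forb c u l z)
                      (∈-filter⁺ unshared? (∈-paths l-light lu lz z≢u) z≢e)))

    recolorable : ¬ Light w → Medium u → Recolorable
    recolorable ¬lw medium = case unshared of λ where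
      (inj₁ few) → few-strong ¬lw few
      (inj₂ not-e) → case medium of λ where
        (inj₁ few) → few-strong ¬lw few
        (inj₂ few) → few-light ¬lw few not-e

  private
    avail-avoiding : ∀ c w zs {k} bad → length zs ≤ k →
      (∀ {z} → z ∈ zs → Pos (c w) (sg w z ∙ c z)) →
      length (light w) + length bad < available k →
      ∃ λ p → (∀ z → z ∈ zs → Pos p (sg w z ∙ c z)) × p ∉ forbs c w (paths w) × p ∉ bad
    avail-avoiding c w zs {k} bad zs≤ at-w few =
      case avail (signed c w zs) (All-signed zs at-w) (forbs c w (paths w) ++ bad)
             (ℕ.<-≤-trans (ℕ.≤-<-trans
               (subst (_≤ length (light w) + length bad)
                 (sym (List.length-++ (forbs c w (paths w))))
                 (ℕ.+-monoˡ-≤ (length bad) (length-forbs c w)))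
               few)
               (available-anti (subst (_≤ k) (sym (List.length-map _ zs)) zs≤))) of λ where
        (p , ps , p∉) → p , (λ _ → signed-lookup ps) , p∉ ∘ ∈-++⁺ˡ , p∉ ∘ ∈-++⁺ʳ (forbs c w (paths w))

    length-∖≤ : ∀ {xs : List (Fin n)} {y k} → y ∈ xs → length xs ≤ suc k → length (xs ∖ y) ≤ k
    length-∖≤ y∈ xs≤ = ℕ.≤-pred (ℕ.<-≤-trans (length-∖-< y∈) xs≤)

  -- Delete `wu`, recolor `w`, then `u`. Here `k` bounds the other non-light neighbors of `w`, and 3
  -- accounts for the bad colors of `u`.
  ¬medium-neighbor : ∀ {w u k} → ¬ Light w → ¬ Light u → Adj w u → Medium u →
    length (strong w) ≤ suc k → ¬ length (light w) + 3 < available k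
  ¬medium-neighbor {w} {u} ¬lw ¬lu wu medium s≤ few =
    case deletion w (u ∷ []) (here wu) of λ where
      (c , proper) →
        case recolorable (Adj-sym wu) (exempt-self (Adj-sym wu)) c
               (λ z z≢w → proper u z (λ (u≡w , _) → Adj⇒≢ wu (sym u≡w)) (z≢w ∘ proj₁)) ¬lw medium of λ where
          (bad , bad≤ , f) →
            case avail-avoiding c w (strong w ∖ u) bad (length-∖≤ (∈-strong⁺ wu ¬lu) s≤)
                   (λ z∈ → let z∈s , z≢u = ∈-∖⁻ z∈ in
                     proper w _ (λ { (_ , here z≡u) → z≢u z≡u })
                                (Adj⇒≢ (proj₁ (∈-strong⁻ z∈s)) ∘ sym ∘ proj₁)
                                (proj₁ (∈-strong⁻ z∈s)))
                   (ℕ.≤-<-trans (ℕ.+-monoʳ-≤ (length (light w)) bad≤) few) of λ where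
              (p , at-w , p∉ , p∉bad) →
                case f (c [ w ≔ p ]) (λ _ z≢w _ → update-≢ c z≢w)
                       (p∉bad ∘ subst (_∈ bad) (update-≡ c w)) of λ where
                  (q , fit-u) → ¬extendable _ (step
                    (step (weaken (λ { (here e) → here e }) (extendable ¬lw proper))
                      (fits (λ z ¬lz z∉ wz → at-w z (∈-∖⁺ (∈-strong⁺ wz ¬lz) (z∉ ∘ here)))
                            (avoids p∉)))
                    fit-u)

  -- Without its edges to `u₁` and `u₂`, `w` has at most one non-light constraint, hence nine
  -- colors; 6 is the number of bad colors of two medium vertices.
  module TwoMediums {w u₁ u₂ : Fin n} (¬lw : ¬ Light w) (¬lu₁ : ¬ Light u₁) (¬lu₂ : ¬ Light u₂)
    (wu₁ : Adj w u₁) (wu₂ : Adj w u₂) (u₁≢u₂ : u₁ ≢ u₂)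
    (s≤ : length (strong w) ≤ 3) (few : length (light w) + 6 < 9) where

    rest : List (Fin n)
    rest = strong w ∖ u₁ ∖ u₂

    length-rest : length rest ≤ 1
    length-rest = length-∖≤ (∈-∖⁺ (∈-strong⁺ wu₂ ¬lu₂) (≢-sym u₁≢u₂)) (length-∖≤ (∈-strong⁺ wu₁ ¬lu₁) s≤)

    D : List (Fin n)
    D = u₁ ∷ u₂ ∷ []

    at-neighbor : ∀ {c u} → ProperExcept w D c → Adj w u → ∀ z → z ≢ w → Fit c u z (c u)
    at-neighbor {u = u} proper wu z z≢w =
      proper u z (λ (u≡w , _) → Adj⇒≢ wu (sym u≡w)) (z≢w ∘ proj₁)

    choose-w : ∀ {c} → ProperExcept w D c → ∀ bad → length bad ≤ 6 →
      ∃ λ p → Extendable (c [ w ≔ p ]) D × p ∉ bad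
    choose-w {c} proper bad bad≤ =
      case avail-avoiding c w rest bad length-rest
             (λ z∈ → let z∈′ , z≢u₂ = ∈-∖⁻ z∈ ; z∈s , z≢u₁ = ∈-∖⁻ z∈′ in
               proper w _ (λ { (_ , here e) → z≢u₁ e ; (_ , there (here e)) → z≢u₂ e })
                          (Adj⇒≢ (proj₁ (∈-strong⁻ z∈s)) ∘ sym ∘ proj₁)
                          (proj₁ (∈-strong⁻ z∈s)))
             (ℕ.≤-<-trans (ℕ.+-monoʳ-≤ (length (light w)) bad≤) few) of λ where
        (p , at-w , p∉ , p∉bad) → p ,
          step (weaken (λ { (here e) → here e }) (extendable ¬lw proper))
            (fits (λ z ¬lz z∉ wz → at-w z (∈-∖⁺ (∈-∖⁺ (∈-strong⁺ wz ¬lz) (z∉ ∘ here)) (z∉ ∘ there ∘ here)))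
                  (avoids p∉)) ,
          p∉bad

    -- The order is `w`, `u₁`, `u₂`. Only `u₂` meets a second changed vertex, namely `u₁`.
    ¬exempt : Medium u₁ → Medium u₂ → ¬ Exempt w u₂ u₁
    ¬exempt medium₁ medium₂ ex = case deletion w D (here wu₁) of λ where
      (c , proper) →
        case recolorable (Adj-sym wu₁) (exempt-self (Adj-sym wu₁)) c
               (at-neighbor proper wu₁) ¬lw medium₁ of λ where
          (bad₁ , bad₁≤ , f₁) →
            case recolorable (Adj-sym wu₂) ex c (at-neighbor proper wu₂) ¬lw medium₂ of λ where
              (bad₂ , bad₂≤ , f₂) →
                case choose-w proper (bad₁ ++ bad₂)
                       (subst (_≤ 6) (sym (List.length-++ bad₁)) (ℕ.+-mono-≤ bad₁≤ bad₂≤)) of λ where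
                  (p , ext , p∉) →
                    case f₁ (c [ w ≔ p ]) (λ _ z≢w _ → update-≢ c z≢w)
                           (p∉ ∘ ∈-++⁺ˡ ∘ subst (_∈ bad₁) (update-≡ c w)) of λ where
                      (p₁ , fit₁) →
                        case f₂ (c [ w ≔ p ] [ u₁ ≔ p₁ ])
                               (λ _ z≢w z≢u₁ → trans (update-≢ _ z≢u₁) (update-≢ c z≢w))
                               (p∉ ∘ ∈-++⁺ʳ bad₁ ∘ subst (_∈ bad₂)
                                 (trans (update-≢ _ (Adj⇒≢ wu₁)) (update-≡ c w))) of λ where
                          (p₂ , fit₂) → ¬extendable _
                            (step (step ext (λ z ¬lz z≢u₁ _ → fit₁ z ¬lz z≢u₁ λ ())) fit₂)

    -- Adjacent `u₁` and `u₂` are not exempt, so their colors are chosen jointly. The colors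
    -- forbidden through light vertices stay as computed from `c`, because `w`, `u₁` and `u₂` are
    -- pairwise adjacent and `no-triangle` leaves no light vertex between them.
    ¬adjacent : FewLight u₁ → FewLight u₂ → ¬ Adj u₁ u₂
    ¬adjacent (s₁≤ , l₁≤) (s₂≤ , l₂≤) u₁u₂ = case deletion w D (here wu₁) of λ where
        (c , proper) →
          case extend-pair (sg u₁ u₂) (sg u₁ w) (sg u₂ w)
                 (signed c u₁ others₁) (signed c u₂ others₂)
                 (length-signed c u₁ others₁ (length-∖∖ wu₁ u₁u₂ ¬lu₂ (Adj⇒≢ wu₂) s₁≤))
                 (length-signed c u₂ others₂ (length-∖∖ wu₂ (Adj-sym u₁u₂) ¬lu₁ (Adj⇒≢ wu₁) s₂≤))
                 (forbs c u₁ (paths u₁)) (forbs c u₂ (paths u₂))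
                 (ℕ.≤-trans (length-forbs c u₁) l₁≤) (ℕ.≤-trans (length-forbs c u₂) l₂≤) of λ where
            (bad , bad≤ , f) →
              case choose-w proper bad (ℕ.≤-trans bad≤ (ℕ.m≤m+n 2 4)) of λ where
                (p , ext , p∉) → case f p∉ of λ where
                  (p₁ , p₂ , p₁p₂ , (p₁w , at₁ , p₁∉) , (p₂w , at₂ , p₂∉)) →
                    ¬extendable _ (step
                      (step (weaken (λ { (here e) → there (here e) ; (there (here e)) → here e }) ext)
                        (fits (fit₂ c p p₂w at₂) (avoids₂ c p p₂∉)))
                      (fits (fit₁ c p p₂ p₁p₂ p₁w at₁) (avoids₁ c p p₂ p₁∉)))
      where
      others₁ others₂ : List (Fin n)
      others₁ = strong u₁ ∖ w ∖ u₂
      others₂ = strong u₂ ∖ w ∖ u₁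

      length-signed : ∀ c u zs {k} → length zs ≤ k → length (signed c u zs) ≤ k
      length-signed c u zs {k} = subst (_≤ k) (sym (List.length-map _ zs))

      length-∖∖ : ∀ {u v} → Adj w u → Adj u v → ¬ Light v → w ≢ v → length (strong u) ≤ 3 →
                      length (strong u ∖ w ∖ v) ≤ 1
      length-∖∖ wu uv ¬lv w≢v u≤ =
        length-∖≤ (∈-∖⁺ (∈-strong⁺ uv ¬lv) (≢-sym w≢v)) (length-∖≤ (∈-strong⁺ (Adj-sym wu) ¬lw) u≤)

      fit₂ : ∀ c p {p₂} → Pos p₂ (sg u₂ w ∙ p) → All (Pos p₂) (signed c u₂ others₂) →
             ∀ z → ¬ Light z → z ∉ (u₁ ∷ []) → Fit (c [ w ≔ p ]) u₂ z p₂
      fit₂ c p {p₂} p₂w at₂ z ¬lz z∉ uz = case z Fin.≟ w of λ where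
        (yes refl) → subst (λ q → Pos p₂ (sg u₂ w ∙ q)) (sym (update-≡ c w)) p₂w
        (no z≢w) → subst (λ q → Pos p₂ (sg u₂ z ∙ q)) (sym (update-≢ c z≢w))
          (signed-lookup at₂ (∈-∖⁺ (∈-∖⁺ (∈-strong⁺ uz ¬lz) z≢w) (z∉ ∘ here)))

      fit₁ : ∀ c p p₂ {p₁} → Pos p₁ (sg u₁ u₂ ∙ p₂) → Pos p₁ (sg u₁ w ∙ p) →
             All (Pos p₁) (signed c u₁ others₁) →
             ∀ z → ¬ Light z → z ∉ [] → Fit (c [ w ≔ p ] [ u₂ ≔ p₂ ]) u₁ z p₁
      fit₁ c p p₂ {p₁} p₁p₂ p₁w at₁ z ¬lz _ uz = case z Fin.≟ u₂ of λ where
        (yes refl) → subst (λ q → Pos p₁ (sg u₁ u₂ ∙ q)) (sym (update-≡ _ u₂)) p₁p₂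
        (no z≢u₂) → case z Fin.≟ w of λ where
          (yes refl) → subst (λ q → Pos p₁ (sg u₁ w ∙ q))
            (sym (trans (update-≢ _ z≢u₂) (update-≡ c w))) p₁w
          (no z≢w) → subst (λ q → Pos p₁ (sg u₁ z ∙ q))
            (sym (trans (update-≢ _ z≢u₂) (update-≢ c z≢w)))
            (signed-lookup at₁ (∈-∖⁺ (∈-∖⁺ (∈-strong⁺ uz ¬lz) z≢w) z≢u₂))

      forb-≡ : ∀ c c′ v l z → c′ z ≡ c z → forb c′ v l z ≡ forb c v l z
      forb-≡ c c′ v l z = cong λ q → neg (sg l v ∙ sg l z ∙ q)

      avoids₂ : ∀ c p {p₂} → p₂ ∉ forbs c u₂ (paths u₂) → Avoids (c [ w ≔ p ]) u₂ p₂
      avoids₂ c p p₂∉ {l} {z} l-light lu₂ lz z≢u₂ eq = avoids p₂∉ l-light lu₂ lz z≢u₂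
        (trans eq (forb-≡ c (c [ w ≔ p ]) u₂ l z (update-≢ c λ { refl → no-triangle l-light lu₂ lz (Adj-sym wu₂) })))

      avoids₁ : ∀ c p p₂ {p₁} → p₁ ∉ forbs c u₁ (paths u₁) → Avoids (c [ w ≔ p ] [ u₂ ≔ p₂ ]) u₁ p₁
      avoids₁ c p p₂ p₁∉ {l} {z} l-light lu₁ lz z≢u₁ eq = avoids p₁∉ l-light lu₁ lz z≢u₁
        (trans eq (forb-≡ c (c [ w ≔ p ] [ u₂ ≔ p₂ ]) u₁ l z (trans
          (update-≢ (c [ w ≔ p ]) λ { refl → no-triangle l-light lu₁ lz u₁u₂ })
          (update-≢ c λ { refl → no-triangle l-light lu₁ lz (Adj-sym wu₁) }))))

-- Discharging

private
  module _ {M : Set} where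

    demand : Dec M → ℕ → ℕ
    demand (no _)  _       = 0
    demand (yes _) zero    = 4
    demand (yes _) (suc _) = 3

    demand-≤4 : ∀ m? k → demand m? k ≤ 4
    demand-≤4 (no _)  _       = z≤n
    demand-≤4 (yes _) zero    = ℕ.≤-refl
    demand-≤4 (yes _) (suc _) = ℕ.n≤1+n 3

    demand-≤3 : ∀ m? {k} → 0 < k → demand m? k ≤ 3
    demand-≤3 (no _)  _       = z≤n
    demand-≤3 (yes _) (s≤s _) = ℕ.≤-refl

    demand-≥3 : ∀ m? k → M → 3 ≤ demand m? k
    demand-≥3 (no ¬m) _      m = contradiction m ¬m
    demand-≥3 (yes _) zero    _ = ℕ.n≤1+n 3
    demand-≥3 (yes _) (suc _) _ = ℕ.≤-refl

    demand-4 : ∀ m? → M → 4 ≤ demand m? 0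
    demand-4 (no ¬m) m = contradiction m ¬m
    demand-4 (yes _) _ = ℕ.≤-refl

    demand-0 : ∀ m? k → ¬ M → demand m? k ≡ 0
    demand-0 (no _)  _ _  = refl
    demand-0 (yes m) _ ¬m = contradiction m ¬m

  -- The charge sent by u to v, where A, B, I and L say that uv is an edge, that v is
  -- light, that u is light or medium, and that u is light.
  module _ {A B I L : Set} where

    amount : Dec A → Dec B → Dec I → Dec L → ℕ → ℕ
    amount (no _)  _       _       _       _ = 0
    amount (yes _) (yes _) _       (yes _) _ = 0
    amount (yes _) (yes _) _       (no _)  _ = 21
    amount (yes _) (no _)  (yes _) _       _ = 0
    amount (yes _) (no _)  (no _)  _       k = k

    amount-nonadjacent : ∀ a? b? i? l? k → ¬ A → amount a? b? i? l? k ≡ 0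
    amount-nonadjacent (no _)  _ _ _ _ _  = refl
    amount-nonadjacent (yes a) _ _ _ _ ¬a = contradiction a ¬a

    amount-idle : ∀ a? b? i? l? k → ¬ B → I → amount a? b? i? l? k ≡ 0
    amount-idle (no _)  _       _       _ _ _  _ = refl
    amount-idle (yes _) (yes b) _       _ _ ¬b _ = contradiction b ¬b
    amount-idle (yes _) (no _)  (yes _) _ _ _  _ = refl
    amount-idle (yes _) (no _)  (no ¬i) _ _ _  i = contradiction i ¬i

    amount-from-light : ∀ a? b? i? l? k → I → L → amount a? b? i? l? k ≡ 0
    amount-from-light (no _)  _       _  _       _ _ _ = refl
    amount-from-light (yes _) (yes _) _  (yes _) _ _ _ = refl
    amount-from-light (yes _) (yes _) _  (no ¬l) _ _ l = contradiction l ¬l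
    amount-from-light (yes a) (no ¬b) i? l?      k i _ = amount-idle (yes a) (no ¬b) i? l? k ¬b i

    amount-to-light : ∀ a? b? i? l? k → A → B → ¬ L → amount a? b? i? l? k ≡ 21
    amount-to-light (no ¬a) _       _ _       _ a _ _  = contradiction a ¬a
    amount-to-light (yes _) (no ¬b) _ _       _ _ b _  = contradiction b ¬b
    amount-to-light (yes _) (yes _) _ (no _)  _ _ _ _  = refl
    amount-to-light (yes _) (yes _) _ (yes l) _ _ _ ¬l = contradiction l ¬l

    amount-need : ∀ a? b? i? l? k → A → ¬ B → ¬ I → amount a? b? i? l? k ≡ k
    amount-need (no ¬a) _       _       _ _ a _  _  = contradiction a ¬a
    amount-need (yes _) (yes b) _       _ _ _ ¬b _  = contradiction b ¬b
    amount-need (yes _) (no _)  (yes i) _ _ _ _  ¬i = contradiction i ¬i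
    amount-need (yes _) (no _)  (no _)  _ _ _ _  _  = refl

    amount-≤-need : ∀ a? b? i? l? k → ¬ B → amount a? b? i? l? k ≤ k
    amount-≤-need (no _)  _       _       _ _ _  = z≤n
    amount-≤-need (yes _) (yes b) _       _ _ ¬b = contradiction b ¬b
    amount-≤-need (yes _) (no _)  (yes _) _ _ _  = z≤n
    amount-≤-need (yes _) (no _)  (no _)  _ _ _  = ℕ.≤-refl

module Discharging {n : ℕ} (G : SignedGraph n)
  (¬colorable : ¬ ∃ (Graph.Proper G))
  (deletion : ∀ w D → Any (Graph.Adj G w) D → ∃ (Graph.ProperExcept G w D)) where

  open Graph G
  open Minimal G ¬colorable deletion

  medium? : ∀ v → Dec (Medium v)
  medium? v =
    ((length (strong v) ℕ.≤? 2) ×-dec (length (light v) ℕ.≤? 4)) ⊎-dec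
    ((length (strong v) ℕ.≤? 3) ×-dec (length (light v) ℕ.≤? 1))

  deg≡ : ∀ v → deg v ≡ length (strong v) + length (light v)
  deg≡ v = trans (sym (count (N v))) (trans (∑-split light? (N v) (λ _ → 1))
      (cong₂ _+_ (count (strong v)) (count (light v))))
    where
    count : ∀ xs → ∑ xs (λ (_ : Fin n) → 1) ≡ length xs
    count xs = trans (∑-const xs 1) (ℕ.*-identityʳ (length xs))

  need : Fin n → ℕ
  need v = demand (medium? v) (length (light v))

  need-≤4 : ∀ v → need v ≤ 4
  need-≤4 v = demand-≤4 (medium? v) (length (light v))

  need-≤3 : ∀ {v l} → l ∈ light v → need v ≤ 3
  need-≤3 {v} l∈ = demand-≤3 (medium? v) (∈-length l∈)

  need-≥3 : ∀ {v} → Medium v → 3 ≤ need v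
  need-≥3 {v} m = demand-≥3 (medium? v) (length (light v)) m

  need-4 : ∀ {v} → Medium v → length (light v) ≡ 0 → 4 ≤ need v
  need-4 {v} m eq = subst (λ k → 4 ≤ demand (medium? v) k) (sym eq) (demand-4 (medium? v) m)

  need-0 : ∀ {v} → ¬ Medium v → need v ≡ 0
  need-0 {v} ¬m = demand-0 (medium? v) (length (light v)) ¬m

  give : Fin n → Fin n → ℕ
  give u v = amount (adj? u v) (light? v) (light? u ⊎-dec medium? u) (light? u) (need v)

  give-nonadjacent : ∀ {u v} → ¬ Adj u v → give u v ≡ 0
  give-nonadjacent {u} {v} = amount-nonadjacent (adj? u v) (light? v) _ _ _

  give-from-light : ∀ {u} v → Light u → give u v ≡ 0
  give-from-light {u} v lu =
    amount-from-light (adj? u v) (light? v) (light? u ⊎-dec medium? u) (light? u) (need v) (inj₁ lu) lu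

  give-to-light : ∀ {u v} → Adj u v → Light v → ¬ Light u → give u v ≡ 21
  give-to-light {u} {v} = amount-to-light (adj? u v) (light? v) _ (light? u) _

  give-from-medium : ∀ {u v} → Medium u → ¬ Light v → give u v ≡ 0
  give-from-medium {u} {v} mu ¬lv =
    amount-idle (adj? u v) (light? v) (light? u ⊎-dec medium? u) (light? u) (need v) ¬lv (inj₂ mu)

  give-need : ∀ {u v} → Adj u v → ¬ Light v → ¬ Light u → ¬ Medium u → give u v ≡ need v
  give-need {u} {v} uv ¬lv ¬lu ¬mu =
    amount-need (adj? u v) (light? v) (light? u ⊎-dec medium? u) (light? u) (need v) uv ¬lv [ ¬lu , ¬mu ]′

  give-≤-need : ∀ u {v} → ¬ Light v → give u v ≤ need v
  give-≤-need u {v} =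
    amount-≤-need (adj? u v) (light? v) (light? u ⊎-dec medium? u) (light? u) (need v)

  Active : Fin n → Set
  Active v = 0 < deg v

  active? : ∀ v → Dec (Active v)
  active? v = 0 ℕ.<? deg v

  -- Isolated vertices, of charge -102, are left out; no charge ever passes through them.
  active : List (Fin n)
  active = filter active? (allFin n)

  adj⇒active : ∀ {x y} → Adj x y → Active x
  adj⇒active xy = ∈-length (∈-N⁺ xy)

  ∑-active : ∀ v f → (∀ {x} → ¬ Adj v x → f x ≡ 0) → ∑ active f ≡ ∑ (N v) f
  ∑-active v f supp = trans
    (sym (∑-filter active? (allFin n) f λ ¬active → supp (¬active ∘ adj⇒active ∘ Adj-sym)))
    (∑-filter (adj? v) (allFin n) f supp)

  ∑-neighbors : ∀ v f → (∀ {x} → ¬ Adj v x → f x ≡ 0) → ∑ active f ≡ ∑ (strong v) f + ∑ (light v) f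
  ∑-neighbors v f supp = trans (∑-active v f supp) (∑-split light? (N v) f)

  -- Medium neighbors of a vertex with few neighbors of either kind

  module _ {w : Fin n} (¬lw : ¬ Light w) (s≤ : length (strong w) ≤ 3) (l≤ : length (light w) ≤ 2) where

    -- In every other case one of `x`, `y` is exempt from the other, against `¬exempt`: a
    -- `FewStrong` vertex has no medium neighbor and tolerates shared light vertices, and two
    -- `FewLight` ones are nonadjacent by `¬adjacent`.
    shared-light : ∀ {x y} → x ∈ strong w → y ∈ strong w → x ≢ y → Medium x → Medium y →
                   (∃ λ l → Light l × Adj l x × Adj l y) × FewLight x
    shared-light {x} {y} x∈ y∈ x≢y mx my = case mx , my of λ where
        (inj₁ fx , _) → contradiction
          (record { distinct = ≢-sym x≢y ; nonadjacent = λ xy → contradiction xy (unrelated fx ¬lx ¬ly my)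
                  ; unshared = inj₁ fx })
          (Two′.¬exempt my mx)
        (inj₂ _ , inj₁ fy) → contradiction
          (record { distinct = x≢y ; nonadjacent = λ yx → contradiction yx (unrelated fy ¬ly ¬lx mx)
                  ; unshared = inj₁ fy })
          (Two.¬exempt mx my)
        (inj₂ fx , inj₂ fy) →
          case Fin.any? (λ l → light? l ×-dec adj? l x ×-dec adj? l y) of λ where
            (yes shared) → shared , fx
            (no none) → contradiction
              (record { distinct = x≢y
                      ; nonadjacent = λ yx → contradiction (Adj-sym yx) (Two.¬adjacent fx fy)
                      ; unshared = inj₂ λ {l} l-light ly lx → none (l , l-light , lx , ly) })
              (Two.¬exempt mx my)
      where
      ¬lx = proj₂ (∈-strong⁻ x∈)
      ¬ly = proj₂ (∈-strong⁻ y∈)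
      wx = proj₁ (∈-strong⁻ x∈)
      wy = proj₁ (∈-strong⁻ y∈)
      few : length (light w) + 6 < 9
      few = s≤s (ℕ.+-monoˡ-≤ 6 l≤)
      module Two  = TwoMediums ¬lw ¬lx ¬ly wx wy x≢y s≤ few
      module Two′ = TwoMediums ¬lw ¬ly ¬lx wy wx (≢-sym x≢y) s≤ few

      -- At most 4 light neighbors and 3 bad colors stay below the 9 colors left by one other
      -- constraint.
      unrelated : ∀ {u v} → FewStrong u → ¬ Light u → ¬ Light v → Medium v → ¬ Adj u v
      unrelated (su≤ , lu≤) ¬lu ¬lv mv uv =
        ¬medium-neighbor {k = 1} ¬lu ¬lv uv mv su≤ (s≤s (ℕ.≤-trans (ℕ.+-monoˡ-≤ 3 lu≤) (ℕ.n≤1+n 7)))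

    -- Two medium neighbors of w share a light vertex, and each has only one.
    ¬three-mediums : ∀ {x y z} → x ∈ strong w → y ∈ strong w → z ∈ strong w →
      x ≢ y → x ≢ z → y ≢ z → Medium x → Medium y → ¬ Medium z
    ¬three-mediums {x} {y} {z} x∈ y∈ z∈ x≢y x≢z y≢z mx my mz =
      case shared-light x∈ y∈ x≢y mx my , shared-light x∈ z∈ x≢z mx mz of λ where
        (((l , l-light , lx , ly) , (_ , lx≤)) , ((l′ , l′-light , l′x , l′z) , _)) →
          case only (light x) lx≤ (∈-light⁺ (Adj-sym lx) l-light) (∈-light⁺ (Adj-sym l′x) l′-light) of λ where
            refl → third-neighbor l-light lx ly l′z x≢y x≢z y≢z
      where
      only : ∀ {A : Set} (xs : List A) {x y} → length xs ≤ 1 → x ∈ xs → y ∈ xs → x ≡ y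
      only (_ ∷ []) _ (here refl) (here refl) = refl
      only (_ ∷ _ ∷ _) (s≤s ()) _ _

    -- If both are medium, they have a light neighbor, so each needs 3 rather than 4.
    two-needs : ∀ {x y} → x ∈ strong w → y ∈ strong w → x ≢ y → need x + need y ≤ 6
    two-needs {x} {y} x∈ y∈ x≢y = case medium? x of λ where
      (no ¬mx) → subst (λ k → k + need y ≤ 6) (sym (need-0 ¬mx)) (ℕ.≤-trans (need-≤4 y) (ℕ.m≤m+n 4 2))
      (yes mx) → case medium? y of λ where
        (no ¬my) → subst (λ k → need x + k ≤ 6) (sym (need-0 ¬my))
          (ℕ.≤-trans (ℕ.+-monoˡ-≤ 0 (need-≤4 x)) (ℕ.m≤m+n 4 2))
        (yes my) → case shared-light x∈ y∈ x≢y mx my of λ where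
          ((l , l-light , lx , ly) , _) → ℕ.+-mono-≤
            (need-≤3 (∈-light⁺ (Adj-sym lx) l-light)) (need-≤3 (∈-light⁺ (Adj-sym ly) l-light))

    needs-≤6 : ∀ xs → length xs ≤ 3 → Unique xs → (∀ {x} → x ∈ xs → x ∈ strong w) → ∑ xs need ≤ 6
    needs-≤6 [] _ _ _ = z≤n
    needs-≤6 (x ∷ []) _ _ _ = ℕ.≤-trans (∑-≤ (x ∷ []) 4 λ {v} _ → need-≤4 v) (ℕ.m≤m+n 4 2)
    needs-≤6 (x ∷ y ∷ []) _ ((x≢y ∷ []) ∷ _) h =
      subst (λ k → need x + k ≤ 6) (sym (ℕ.+-identityʳ (need y))) (two-needs (h (here refl)) (h (there (here refl))) x≢y)
    needs-≤6 (x ∷ y ∷ z ∷ []) _ ((x≢y ∷ x≢z ∷ []) ∷ (y≢z ∷ []) ∷ _) h =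
      subst (_≤ 6) (sym (cong (λ k → need x + (need y + k)) (ℕ.+-identityʳ (need z)))) (case medium? x of λ where
        (no ¬mx) → subst (λ k → k + (need y + need z) ≤ 6) (sym (need-0 ¬mx)) (two-needs y∈ z∈ y≢z)
        (yes mx) → case medium? y of λ where
          (no ¬my) → subst (λ k → need x + (k + need z) ≤ 6) (sym (need-0 ¬my)) (two-needs x∈ z∈ x≢z)
          (yes my) → case medium? z of λ where
            (no ¬mz) → subst (λ k → need x + k ≤ 6)
              (sym (trans (cong (need y +_) (need-0 ¬mz)) (ℕ.+-identityʳ (need y)))) (two-needs x∈ y∈ x≢y)
            (yes mz) → contradiction mz (¬three-mediums x∈ y∈ z∈ x≢y x≢z y≢z mx my))
      where
      x∈ = h (here refl)
      y∈ = h (there (here refl))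
      z∈ = h (there (there (here refl)))
    needs-≤6 (_ ∷ _ ∷ _ ∷ _ ∷ _) (s≤s (s≤s (s≤s ()))) _ _

    some-nonmedium : ∀ xs → length xs ≡ 3 → Unique xs → (∀ {x} → x ∈ xs → x ∈ strong w) →
                     ∃ λ x → x ∈ xs × ¬ Medium x
    some-nonmedium (x ∷ y ∷ z ∷ []) _ ((x≢y ∷ x≢z ∷ []) ∷ (y≢z ∷ []) ∷ _) h = case medium? x of λ where
      (no ¬mx) → x , here refl , ¬mx
      (yes mx) → case medium? y of λ where
        (no ¬my) → y , there (here refl) , ¬my
        (yes my) → z , there (there (here refl)) ,
          ¬three-mediums (h (here refl)) (h (there (here refl))) (h (there (there (here refl))))
            x≢y x≢z y≢z mx my
    some-nonmedium (_ ∷ []) ()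
    some-nonmedium (_ ∷ _ ∷ []) ()
    some-nonmedium (_ ∷ _ ∷ _ ∷ _ ∷ _) ()

  -- Final charge of each vertex

  in-≥-strong : ∀ v → ∑ (strong v) (λ u → give u v) ≤ ∑ active (λ u → give u v)
  in-≥-strong v = subst (∑ (strong v) (λ u → give u v) ≤_)
    (sym (∑-neighbors v (λ u → give u v) λ ¬vx → give-nonadjacent (¬vx ∘ Adj-sym)))
    (ℕ.m≤m+n _ _)

  out-≤ : ∀ v d → ¬ Light v → ∑ (strong v) (give v) ≤ d →
          ∑ active (give v) ≤ d + length (light v) * 21
  out-≤ v d ¬lv strong≤ = subst (_≤ d + length (light v) * 21)
    (sym (∑-neighbors v (give v) give-nonadjacent))
    (ℕ.+-mono-≤ strong≤ (∑-≤ (light v) 21 λ u∈ → let vu , lu = ∈-light⁻ u∈ in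
      ℕ.≤-reflexive (give-to-light vu lu ¬lv)))

  Balanced : Fin n → Set
  Balanced v = 102 + ∑ active (give v) ≤ 30 * deg v + ∑ active (λ u → give u v)

  balance : ∀ v {s k} → ¬ Light v → length (strong v) ≡ s → length (light v) ≡ k → ∀ d e →
    ∑ (strong v) (give v) ≤ d → e ≤ ∑ (strong v) (λ u → give u v) →
    102 + (d + k * 21) ≤ 30 * (s + k) + e → Balanced v
  balance v ¬lv refl refl d e out≤ in≥ enough = begin
    102 + ∑ active (give v)                       ≤⟨ ℕ.+-monoʳ-≤ 102 (out-≤ v d ¬lv out≤) ⟩
    102 + (d + length (light v) * 21)             ≤⟨ enough ⟩
    30 * (length (strong v) + length (light v)) + e
      ≤⟨ ℕ.+-mono-≤ (ℕ.≤-reflexive (cong (30 *_) (sym (deg≡ v)))) (ℕ.≤-trans in≥ (in-≥-strong v)) ⟩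
    30 * deg v + ∑ active (λ u → give u v)        ∎
    where open ℕ.≤-Reasoning

  light-balanced : ∀ v → Light v → Active v → Balanced v
  light-balanced v lv active-v = begin
    102 + ∑ active (give v)                ≡⟨ cong (102 +_) (∑-active v (give v) give-nonadjacent) ⟩
    102 + ∑ (N v) (give v)                 ≤⟨ ℕ.+-monoʳ-≤ 102 (∑-≤ (N v) 0 λ {u} _ →
                                                ℕ.≤-reflexive (give-from-light u lv)) ⟩
    102 + deg v * 0                        ≡⟨ cong (102 +_) (ℕ.*-zeroʳ (deg v)) ⟩
    30 * 2 + 2 * 21                        ≡⟨ cong (λ d → 30 * d + d * 21) (sym deg≡2) ⟩
    30 * deg v + deg v * 21                ≤⟨ ℕ.+-monoʳ-≤ (30 * deg v) (∑-≥ (N v) 21 λ u∈ →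
                                                let vu = ∈-N⁻ u∈ in ℕ.≤-reflexive (sym
                                                (give-to-light (Adj-sym vu) lv λ lu → light-independent lv lu vu))) ⟩
    30 * deg v + ∑ (N v) (λ u → give u v)  ≡⟨ cong (30 * deg v +_) (sym (∑-active v (λ u → give u v)
                                                λ ¬vx → give-nonadjacent (¬vx ∘ Adj-sym))) ⟩
    30 * deg v + ∑ active (λ u → give u v) ∎
    where
    open ℕ.≤-Reasoning
    open Remove (Fin._≟_ {n}) using (_∖_; ∈-∖⁺; length-∖-<)
    two : ∀ xs → 0 < length xs → (∀ {x} → x ∈ xs → Adj v x) → 2 ≤ deg v
    two [] () _
    two (x ∷ _) _ h = let y , vy , y≢x = light-two lv (h (here refl)) in
      ℕ.≤-trans (s≤s (∈-length (∈-∖⁺ (∈-N⁺ vy) y≢x))) (length-∖-< (∈-N⁺ (h (here refl))))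
    deg≡2 : deg v ≡ 2
    deg≡2 = ℕ.≤-antisym lv (two (N v) active-v ∈-N⁻)

  medium-out : ∀ {v} → Medium v → ∑ (strong v) (give v) ≤ 0
  medium-out {v} mv = subst (∑ (strong v) (give v) ≤_) (ℕ.*-zeroʳ (length (strong v)))
    (∑-≤ (strong v) 0 λ u∈ → ℕ.≤-reflexive (give-from-medium mv (proj₂ (∈-strong⁻ u∈))))

  give-from : ∀ {v u} → ¬ Light v → u ∈ strong v → ¬ Medium u → give u v ≡ need v
  give-from ¬lv u∈ ¬mu = let vu , ¬lu = ∈-strong⁻ u∈ in give-need (Adj-sym vu) ¬lv ¬lu ¬mu

  many-light : ∀ {v k} → ¬ Light v → length (light v) ≡ suc k → available (length (strong v)) ≤ suc k
  many-light {v} ¬lv eq with light v in eq′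
  ... | l ∷ ls = subst (available (length (strong v)) ≤_) (trans (cong length eq′) eq)
    (strong-neighbors-many {l = l} ¬lv (subst (l ∈_) (sym eq′) (here refl)))

  nonlight-balanced : ∀ v → ¬ Light v → Balanced v
  nonlight-balanced v ¬lv = by-size (length (strong v)) (length (light v)) refl refl
    where
    nonlight : ∀ {s k} → length (strong v) ≡ s → length (light v) ≡ k → ¬ (s + k ≤ 2)
    nonlight refl refl sk≤ = ¬lv (subst (_≤ 2) (sym (deg≡ v)) sk≤)

    needs : ∑ (strong v) (give v) ≤ ∑ (strong v) need
    needs = ∑-mono (strong v) λ u∈ → give-≤-need v (proj₂ (∈-strong⁻ u∈))

    needs-≤ : ∀ {s} → length (strong v) ≡ s → ∑ (strong v) (give v) ≤ s * 4
    needs-≤ refl = ℕ.≤-trans needs (∑-≤ (strong v) 4 λ {u} _ → need-≤4 u)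

    -- k₀ light neighbors suffice, and each further one is worth 30 - 21.
    high : ∀ s k₀ k d → k₀ ≤ k → length (strong v) ≡ s → length (light v) ≡ k →
           ∑ (strong v) (give v) ≤ d → 102 + (d + k₀ * 21) ≤ 30 * (s + k₀) → Balanced v
    high s k₀ k d k₀≤k s≡ k≡ out≤ enough =
      balance v ¬lv s≡ k≡ d 0 out≤ z≤n (excess (ℕ.m≤n⇒∃[o]m+o≡n k₀≤k))
      where
      excess : (∃ λ j → k₀ + j ≡ k) → 102 + (d + k * 21) ≤ 30 * (s + k) + 0
      excess (j , refl) = subst₂ _≤_ (lhs d k₀ j) (rhs s k₀ j)
        (ℕ.+-mono-≤ enough (ℕ.*-monoʳ-≤ j (ℕ.m≤m+n 21 9)))
        where
        lhs : ∀ d k₀ j → 102 + (d + k₀ * 21) + j * 21 ≡ 102 + (d + (k₀ + j) * 21)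
        lhs = solve-∀
        rhs : ∀ s k₀ j → 30 * (s + k₀) + j * 30 ≡ 30 * (s + (k₀ + j)) + 0
        rhs = solve-∀

    no-medium : ∀ k {u} → length (strong v) ≤ suc k → length (light v) + 3 < available k →
                u ∈ strong v → ¬ Medium u
    no-medium k s≤ few u∈ mu = let vu , ¬lu = ∈-strong⁻ u∈ in
      ¬medium-neighbor {k = k} ¬lv ¬lu vu mu s≤ few

    by-size : ∀ s k → length (strong v) ≡ s → length (light v) ≡ k → Balanced v
    by-size 0 0 s≡ k≡ = contradiction z≤n (nonlight s≡ k≡)
    by-size 1 0 s≡ k≡ = contradiction (s≤s z≤n) (nonlight s≡ k≡)
    by-size 2 0 s≡ k≡ = contradiction ℕ.≤-refl (nonlight s≡ k≡)
    -- 90 + 3 * 4 = 102. All three neighbors pay: none is medium, since 0 + 3 is less than the 4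
    -- colors left by two constraints.
    by-size 3 0 s≡ k≡ = balance v ¬lv s≡ k≡ 0 12 (medium-out medium)
        (subst (λ s → s * 4 ≤ ∑ (strong v) (λ u → give u v)) s≡ (∑-≥ (strong v) 4 λ u∈ →
          ℕ.≤-trans (need-4 medium k≡) (ℕ.≤-reflexive (sym (give-from ¬lv u∈
            (no-medium 2 (ℕ.≤-reflexive s≡) (ℕ.≤-reflexive (cong (λ k → suc (k + 3)) k≡)) u∈))))))
        ℕ.≤-refl
      where
      medium : Medium v
      medium = inj₂ (ℕ.≤-reflexive s≡ , ℕ.≤-trans (ℕ.≤-reflexive k≡) z≤n)
    by-size 0 (suc k) s≡ k≡ = high 0 20 (suc k)  0
      (subst (λ s → available s ≤ suc k) s≡ (many-light ¬lv k≡)) s≡ k≡ (needs-≤ s≡) (ℕ.≤ᵇ⇒≤ _ _ _)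
    by-size 1 (suc k) s≡ k≡ = high 1 9 (suc k) 4
      (subst (λ s → available s ≤ suc k) s≡ (many-light ¬lv k≡)) s≡ k≡ (needs-≤ s≡) (ℕ.≤ᵇ⇒≤ _ _ _)
    by-size 2 1 s≡ k≡ = contradiction (subst (λ s → available s ≤ 1) s≡ (many-light ¬lv k≡)) λ where
      (s≤s ())
    by-size 2 2 s≡ k≡ = contradiction (subst (λ s → available s ≤ 2) s≡ (many-light ¬lv k≡)) λ where
      (s≤s (s≤s ()))
    by-size 2 3 s≡ k≡ = contradiction (subst (λ s → available s ≤ 3) s≡ (many-light ¬lv k≡)) λ where
      (s≤s (s≤s (s≤s ())))
    -- 180 + 2 * 3 = 102 + 4 * 21, and 4 + 3 < 9 excludes medium neighbors.
    by-size 2 4 s≡ k≡ = balance v ¬lv s≡ k≡ 0 6 (medium-out medium)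
        (subst (λ s → s * 3 ≤ ∑ (strong v) (λ u → give u v)) s≡ (∑-≥ (strong v) 3 λ u∈ →
          ℕ.≤-trans (need-≥3 medium) (ℕ.≤-reflexive (sym (give-from ¬lv u∈
            (no-medium 1 (ℕ.≤-reflexive s≡)
              (subst (λ k → k + 3 < 9) (sym k≡) (ℕ.≤ᵇ⇒≤ _ _ _)) u∈))))))
        (ℕ.≤ᵇ⇒≤ _ _ _)
      where
      medium : Medium v
      medium = inj₁ (ℕ.≤-reflexive s≡ , ℕ.≤-reflexive k≡)
    -- The surplus is only 3, but 5 + 3 < 9 still excludes medium neighbors, so nothing is asked
    -- for.
    by-size 2 5 s≡ k≡ = high 2 5 5 0 ℕ.≤-refl s≡ k≡
      (ℕ.≤-trans needs (subst (∑ (strong v) need ≤_) (ℕ.*-zeroʳ (length (strong v)))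
        (∑-≤ (strong v) 0 λ u∈ → ℕ.≤-reflexive (need-0
          (no-medium 1 (ℕ.≤-reflexive s≡) (subst (λ k → k + 3 < 9) (sym k≡) ℕ.≤-refl) u∈)))))
      (ℕ.≤ᵇ⇒≤ _ _ _)
    by-size 2 k@(suc (suc (suc (suc (suc (suc _)))))) s≡ k≡ =
      high 2 6 k 8 (ℕ.m≤m+n 6 _) s≡ k≡ (needs-≤ s≡) (ℕ.≤ᵇ⇒≤ _ _ _)
    -- 120 + 3 = 102 + 21: one payment suffices, and some non-light neighbor is not medium.
    by-size 3 1 s≡ k≡ = balance v ¬lv s≡ k≡ 0 3 (medium-out medium)
        (case some-nonmedium ¬lv (ℕ.≤-reflexive s≡) (ℕ.≤-trans (ℕ.≤-reflexive k≡) (ℕ.n≤1+n 1))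
                (strong v) s≡ (strong-unique v) id of λ where
          (x , x∈ , ¬mx) → ℕ.≤-trans (need-≥3 medium)
            (ℕ.≤-trans (ℕ.≤-reflexive (sym (give-from ¬lv x∈ ¬mx))) (∑-≥-one x∈)))
        (ℕ.≤ᵇ⇒≤ _ _ _)
      where
      medium : Medium v
      medium = inj₂ (ℕ.≤-reflexive s≡ , ℕ.≤-reflexive k≡)
    -- The tight case: 150 = 102 + 6 + 2 * 21.
    by-size 3 2 s≡ k≡ = high 3 2 2 6 ℕ.≤-refl s≡ k≡
      (ℕ.≤-trans needs (needs-≤6 ¬lv (ℕ.≤-reflexive s≡) (ℕ.≤-reflexive k≡)
        (strong v) (ℕ.≤-reflexive s≡) (strong-unique v) id))
      (ℕ.≤ᵇ⇒≤ _ _ _)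
    by-size 3 k@(suc (suc (suc _))) s≡ k≡ =
      high 3 3 k 12 (ℕ.m≤m+n 3 _) s≡ k≡ (needs-≤ s≡) (ℕ.≤ᵇ⇒≤ _ _ _)
    by-size s@(suc (suc (suc (suc r)))) k s≡ k≡ =
      high s 0 k (s * 4) z≤n s≡ k≡ (needs-≤ s≡) (subst₂ _≤_ (lhs r) (rhs r)
        (ℕ.+-mono-≤ (ℕ.m≤m+n 118 2) (ℕ.*-monoʳ-≤ r (ℕ.m≤m+n 4 26))))
      where
      lhs : ∀ r → 118 + r * 4 ≡ 102 + ((4 + r) * 4 + 0)
      lhs = solve-∀
      rhs : ∀ r → 120 + r * 30 ≡ 30 * ((4 + r) + 0)
      rhs = solve-∀

  balanced : ∀ {v} → v ∈ active → Balanced v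
  balanced {v} v∈ = case light? v of λ where
    (yes lv) → light-balanced v lv (proj₂ (∈-filter⁻ active? {xs = allFin n} v∈))
    (no ¬lv) → nonlight-balanced v ¬lv


  -- What is given equals what is received once the sums are exchanged, so it cancels; dividing by 6
  -- turns 102 and 30 into 17 and 5.
  dense : 17 * length active ≤ 5 * ∑ active (λ x → ∑ active (edge x))
  dense = ℕ.*-cancelˡ-≤ 6 (subst₂ _≤_ (ℕ.*-assoc 6 17 (length active)) (ℕ.*-assoc 6 5 total)
    (ℕ.+-cancelʳ-≤ (∑ active (λ x → ∑ active (give x))) _ _ (begin
      102 * length active + given
        ≡⟨ cong (_+ given) (trans (ℕ.*-comm 102 (length active)) (sym (∑-const active 102))) ⟩
      ∑ active (λ _ → 102) + given
        ≡⟨ sym (∑-+ active _ _) ⟩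
      ∑ active (λ x → 102 + ∑ active (give x))
        ≤⟨ ∑-mono active balanced ⟩
      ∑ active (λ x → 30 * deg x + ∑ active (λ y → give y x))
        ≡⟨ ∑-+ active _ _ ⟩
      ∑ active (λ x → 30 * deg x) + ∑ active (λ x → ∑ active (λ y → give y x))
        ≤⟨ ℕ.+-mono-≤ (∑-mono active λ {x} _ → ℕ.≤-reflexive (cong (30 *_) (deg-active x)))
                      (ℕ.≤-reflexive (∑-comm active active λ x y → give y x)) ⟩
      ∑ active (λ x → 30 * ∑ active (edge x)) + given
        ≡⟨ cong (_+ given) (∑-* active 30 (λ x → ∑ active (edge x))) ⟩
      30 * ∑ active (λ x → ∑ active (edge x)) + given ∎)))
    where
    open ℕ.≤-Reasoning
    total : ℕ
    total = ∑ active (λ x → ∑ active (edge x))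

    given : ℕ
    given = ∑ active (λ x → ∑ active (give x))

    deg-active : ∀ x → deg x ≡ ∑ active (edge x)
    deg-active x = sym (trans (∑-active x (edge x) λ {y} → indicator-0 (adj? x y))
      (trans (∑-indicator (adj? x) (N x)) (cong length (List.filter-all (adj? x) (All.tabulate ∈-N⁻)))))

  active-unique : Unique active
  active-unique = Unique.filter⁺ active? (Unique.allFin⁺ n)

  active-nonempty : 0 < length active
  active-nonempty = nonempty active refl
    where
    nonempty : ∀ xs → xs ≡ active → 0 < length xs
    nonempty (_ ∷ _) _ = s≤s z≤n
    nonempty [] eq = contradiction ((λ _ → zero , Sign.+) , λ x y xy →
      case subst (x ∈_) (sym eq) (∈-filter⁺ active? (∈-allFin x) (adj⇒active xy)) of λ ()) ¬colorable

-- Sparse graphs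

any-color? : ∀ {P : Color → Set} → (∀ p → Dec (P p)) → Dec (∃ P)
any-color? P? = map′ (λ p → let x , _ , px = find p in x , px) (λ (x , px) → lose (∈-colors x) px)
                     (Any.any? P? colors)

-- A coloring agrees with the one rebuilt from its head and tail only pointwise, so `P` has to
-- respect pointwise equality.
any-coloring? : ∀ n {P : (Fin n → Color) → Set} → (∀ {c d} → (∀ x → c x ≡ d x) → P c → P d) →
                (∀ c → Dec (P c)) → Dec (∃ P)
any-coloring? zero resp P? = map′ (VF.[] ,_) (λ (c , pc) → resp (λ ()) pc) (P? VF.[])
any-coloring? (suc n) resp P? = map′
  (λ (p , c , pc) → p VF.∷ c , pc)
  (λ (c , pc) → c zero , VF.tail c , resp (λ { zero → refl ; (suc _) → refl }) pc)
  (any-color? λ p → any-coloring? n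
    (λ c≗d → resp λ { zero → refl ; (suc x) → c≗d x })
    (λ c → P? (p VF.∷ c)))

module _ {n : ℕ} where

  Deleted : Fin n → List (Fin n) → Fin n → Fin n → Set
  Deleted w D x y = (x ≡ w × y ∈ D) ⊎ (y ≡ w × x ∈ D)

  deleted? : ∀ w D x y → Dec (Deleted w D x y)
  deleted? w D x y = ((x Fin.≟ w) ×-dec Any.any? (y Fin.≟_) D) ⊎-dec
                     ((y Fin.≟ w) ×-dec Any.any? (x Fin.≟_) D)

  delete : SignedGraph n → Fin n → List (Fin n) → SignedGraph n
  delete G w D .adj x y = if does (deleted? w D x y) then nothing else adj G x y
  delete G w D .adj-sym x y = cong₂ (λ b m → if b then nothing else m)
    (∨-comm (does ((x Fin.≟ w) ×-dec Any.any? (y Fin.≟_) D)) _) (adj-sym G x y)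
  delete G w D .adj-irrefl x = trans
    (cong (λ m → if does (deleted? w D x x) then nothing else m) (adj-irrefl G x))
    (if-const (does (deleted? w D x x)))
    where
    if-const : ∀ b → (if b then nothing else nothing) ≡ nothing {A = Sign}
    if-const false = refl
    if-const true  = refl

  delete-kept : ∀ G {w D x y} → ¬ Deleted w D x y → adj (delete G w D) x y ≡ adj G x y
  delete-kept G {w} {D} {x} {y} ¬d =
    cong (λ b → if b then nothing else adj G x y) (dec-false (deleted? w D x y) ¬d)

  delete-deleted : ∀ G {w D x y} → Deleted w D x y → adj (delete G w D) x y ≡ nothing
  delete-deleted G {w} {D} {x} {y} d =
    cong (λ b → if b then nothing else adj G x y) (dec-true (deleted? w D x y) d)

  delete-⊆ : ∀ G w D x y → Graph.Adj (delete G w D) x y → Graph.Adj G x y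
  delete-⊆ G w D x y a eq = case deleted? w D x y of λ where
    (yes d) → a (delete-deleted G d)
    (no ¬d) → a (trans (delete-kept G ¬d) eq)

  edge-delete : ∀ G w D x y → Graph.edge (delete G w D) x y ≤ Graph.edge G x y
  edge-delete G w D x y =
    indicator-≤ (Graph.adj? (delete G w D) x y) (Graph.adj? G x y) (delete-⊆ G w D x y)

  edgeSum : SignedGraph n → List (Fin n) → ℕ
  edgeSum G xs = ∑ xs (λ x → ∑ xs (Graph.edge G x))

  -- The bound on `mad` for induced subgraphs, cleared of denominators. `edgeSum` runs over ordered
  -- pairs, so it already contains the factor 2, and it can only drop when edges are deleted.
  Sparse : SignedGraph n → Set
  Sparse G = ∀ xs → Unique xs → 0 < length xs → 5 * edgeSum G xs < 17 * length xs

  delete-sparse : ∀ G w D → Sparse G → Sparse (delete G w D)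
  delete-sparse G w D sparse xs u ne = ℕ.≤-<-trans
    (ℕ.*-monoʳ-≤ 5 (∑-mono xs λ {x} _ → ∑-mono xs λ {y} _ → edge-delete G w D x y))
    (sparse xs u ne)

  delete-smaller : ∀ G {w D} → Any (Graph.Adj G w) D →
                   edgeSum (delete G w D) (allFin n) < edgeSum G (allFin n)
  delete-smaller G {w} {D} any = case find any of λ where
    (d , d∈ , wd) → ∑-mono-<
      (λ x → ∑-mono (allFin n) λ {y} _ → edge-delete G w D x y) (∈-allFin w)
      (∑-mono-< (λ y → edge-delete G w D w y) (∈-allFin d)
        (indicator-< (Graph.adj? (delete G w D) w d) (Graph.adj? G w d)
          (λ a → a (delete-deleted G (inj₁ (refl , d∈)))) wd))

  colorable? : ∀ G → Dec (∃ (Graph.Proper {n} G))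
  colorable? G = any-coloring? n
    (λ {c} {d} c≗d proper x y xy → subst₂ (λ p q → Pos p (sg x y ∙ q)) (c≗d x) (c≗d y) (proper x y xy))
    (λ c → Fin.all? λ x → Fin.all? λ y → adj? x y →-dec Pos? (c x) (sg x y ∙ c y))
    where open Graph G

  -- The minimal counterexample in constructive form: colorability is decidable, and if it fails,
  -- the induction hypothesis provides `deletion`, whereupon `active` is too dense.
  color : ∀ m G → edgeSum G (allFin n) < m → Sparse G → ∃ (Graph.Proper G)
  color zero G () _
  color (suc m) G (s≤s size≤) sparse = case colorable? G of λ where
      (yes c) → c
      (no ¬c) → contradiction (Discharging.dense G ¬c deletion)
        (ℕ.<⇒≱ (sparse (Discharging.active G ¬c deletion) (Discharging.active-unique G ¬c deletion)
                         (Discharging.active-nonempty G ¬c deletion)))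
    where
    deletion : ∀ w D → Any (Graph.Adj G w) D → ∃ (Graph.ProperExcept G w D)
    deletion w D any =
      case color m (delete G w D) (ℕ.<-≤-trans (delete-smaller G any) size≤) (delete-sparse G w D sparse) of λ where
        (c , proper) → c , λ x y ¬₁ ¬₂ xy →
          let kept = delete-kept G {w} {D} {x} {y} [ ¬₁ , ¬₂ ]′ in
          subst (λ m → Pos (c x) (fromMaybe Sign.+ m ∙ c y)) kept
            (proper x y (xy ∘ trans (sym kept)))

-- The maximum average degree

module _ {A : Set} {P : A → Set} (P? : ∀ x → Dec (P x)) where

  ∣tabulate∣ : ∀ {m} (f : Fin m → A) →
    ∣ Vec.tabulate (λ i → does (P? (f i))) ∣ ≡ length (filter P? (List.tabulate f))
  ∣tabulate∣ {zero}  f = refl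
  ∣tabulate∣ {suc m} f with P? (f zero)
  ... | yes _ = cong suc (∣tabulate∣ (f ∘ suc))
  ... | no _  = ∣tabulate∣ (f ∘ suc)

  ∈-tabulate⁺ : ∀ {m} (f : Fin m → A) {i} → P (f i) → i Subset.∈ Vec.tabulate (λ i → does (P? (f i)))
  ∈-tabulate⁺ f {i} p = lookup⇒[]= i _ (trans (lookup∘tabulate _ i) (dec-true (P? (f i)) p))

  ∈-tabulate⁻ : ∀ {m} (f : Fin m → A) {i} → i Subset.∈ Vec.tabulate (λ i → does (P? (f i))) → P (f i)
  ∈-tabulate⁻ f {i} i∈ = from-does (P? (f i)) (trans (sym (lookup∘tabulate _ i)) ([]=⇒lookup i∈))
    where
    from-does : ∀ {B : Set} (b? : Dec B) → does b? ≡ true → B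
    from-does (yes b) _ = b

length-⊆ : ∀ {A : Set} (_≟_ : DecidableEquality A) {xs} ys → Unique xs →
           (∀ {x} → x ∈ xs → x ∈ ys) → length xs ≤ length ys
length-⊆ _≟_ {xs} ys u xs⊆ys = ℕ.≮⇒≥ λ ys<xs →
  let x , x∈ , x∉ = Remove.fresh _≟_ ys u ys<xs in x∉ (xs⊆ys x∈)

∑-cartesianProduct : ∀ {A B : Set} (xs : List A) (ys : List B) f →
  ∑ (cartesianProduct xs ys) f ≡ ∑ xs (λ x → ∑ ys (λ y → f (x , y)))
∑-cartesianProduct [] ys f = refl
∑-cartesianProduct (x ∷ xs) ys f = trans (∑-++ (map (x ,_) ys) (cartesianProduct xs ys))
  (cong₂ _+_ (∑-map ys) (∑-cartesianProduct xs ys f))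
  where
  ∑-++ : ∀ us vs → ∑ (us ++ vs) f ≡ ∑ us f + ∑ vs f
  ∑-++ [] vs = refl
  ∑-++ (u ∷ us) vs = trans (cong (f u +_) (∑-++ us vs)) (sym (ℕ.+-assoc (f u) _ _))
  ∑-map : ∀ ys → ∑ (map (x ,_) ys) f ≡ ∑ ys (λ y → f (x , y))
  ∑-map [] = refl
  ∑-map (y ∷ ys) = cong (f (x , y) +_) (∑-map ys)

/-<-/ : ∀ a b c d .⦃ _ : NonZero b ⦄ .⦃ _ : NonZero d ⦄ → (ℤ.+ a) / b ℚ.< (ℤ.+ c) / d → a * d < c * b
/-<-/ a (suc b) c (suc d) lt = ℤ.drop‿+<+ (subst₂ ℤ._<_ (sym (ℤ.pos-* a (suc d))) (sym (ℤ.pos-* c (suc b)))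
  (ℚᵘ.drop-*<* (ℚᵘ.<-respˡ-≃ (ℚ.toℚᵘ-fromℚᵘ (ℚᵘ.mkℚᵘ (ℤ.+ a) b))
    (ℚᵘ.<-respʳ-≃ (ℚ.toℚᵘ-fromℚᵘ (ℚᵘ.mkℚᵘ (ℤ.+ c) d)) (ℚ.toℚᵘ-mono-< lt)))))

module _ {n : ℕ} (G : SignedGraph n) where

  open Graph G using (adj?; Adj-sym; Adj⇒≢) renaming (edge to adjacency)

  -- Every adjacent pair is counted in both orders.
  edgeSum≤ : ∀ xs → edgeSum G xs ≤ 2 * length (filter (edge? G) (cartesianProduct xs xs))
  edgeSum≤ xs = begin
    edgeSum G xs
      ≤⟨ ∑-mono xs (λ {x} _ → ∑-mono xs λ {y} _ → ordered x y) ⟩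
    ∑ xs (λ x → ∑ xs (λ y → ind (x , y) + ind (y , x)))
      ≤⟨ ∑-mono xs (λ {x} _ → ℕ.≤-reflexive (∑-+ xs (λ y → ind (x , y)) (λ y → ind (y , x)))) ⟩
    ∑ xs (λ x → ∑ xs (λ y → ind (x , y)) + ∑ xs (λ y → ind (y , x)))
      ≡⟨ ∑-+ xs _ _ ⟩
    ∑ xs (λ x → ∑ xs (λ y → ind (x , y))) + ∑ xs (λ x → ∑ xs (λ y → ind (y , x)))
      ≡⟨ cong (forward +_) (sym (∑-comm xs xs λ x y → ind (x , y))) ⟩
    forward + forward
      ≡⟨ cong₂ _+_ forward≡ (trans forward≡ (sym (ℕ.+-identityʳ _))) ⟩
    2 * length (filter (edge? G) (cartesianProduct xs xs)) ∎
    where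
    open ℕ.≤-Reasoning
    ind : Fin n × Fin n → ℕ
    ind e = indicator (edge? G e)

    forward : ℕ
    forward = ∑ xs (λ x → ∑ xs (λ y → ind (x , y)))

    forward≡ : forward ≡ length (filter (edge? G) (cartesianProduct xs xs))
    forward≡ = trans (sym (∑-cartesianProduct xs xs ind)) (∑-indicator (edge? G) (cartesianProduct xs xs))

    ordered : ∀ x y → adjacency x y ≤ ind (x , y) + ind (y , x)
    ordered x y = case adj? x y of λ where
      (no ¬xy) → subst (_≤ ind (x , y) + ind (y , x)) (sym (indicator-0 (adj? x y) ¬xy)) z≤n
      (yes xy) → case Fin.<-cmp x y of λ where
        (tri< x<y _ _) → ℕ.≤-trans (indicator-≤ (adj? x y) (edge? G (x , y)) λ xy → x<y , xy) (ℕ.m≤m+n _ _)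
        (tri≈ _ x≡y _) → contradiction x≡y (Adj⇒≢ xy)
        (tri> _ _ y<x) → ℕ.≤-trans (indicator-≤ (adj? x y) (edge? G (y , x)) λ xy → y<x , Adj-sym xy)
                           (ℕ.m≤n+m _ (ind (x , y)))

  mad⇒sparse : mad G ℚ.< (ℤ.+ 17) / 5 → Sparse G
  mad⇒sparse mad< xs u ne = begin-strict
      5 * edgeSum G xs            ≤⟨ ℕ.*-monoʳ-≤ 5 (ℕ.≤-trans (edgeSum≤ xs) (ℕ.*-monoʳ-≤ 2 pairs≤)) ⟩
      5 * (2 * ∣ E ∣)             ≡⟨ ℕ.*-comm 5 (2 * ∣ E ∣) ⟩
      2 * ∣ E ∣ * 5               <⟨ /-<-/ (2 * ∣ E ∣) ∣ V ∣ 17 5 ⦃ nonempty ⦄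
                                       (ℚ.≤-<-trans (averageDegree≤mad G S) mad<) ⟩
      17 * ∣ V ∣                  ≤⟨ ℕ.*-monoʳ-≤ 17 V≤ ⟩
      17 * length xs              ∎
    where
    open ℕ.≤-Reasoning
    in-xs? : ∀ x → Dec (x ∈ xs)
    in-xs? x = Any.any? (x Fin.≟_) xs

    V : Subset n
    V = Vec.tabulate (λ x → does (in-xs? x))

    both? : ∀ (e : Fin n × Fin n) → Dec (proj₁ e ∈ xs × proj₂ e ∈ xs)
    both? (x , y) = in-xs? x ×-dec in-xs? y

    E : Subset (length (edges G))
    E = Vec.tabulate (λ i → does (both? (List.lookup (edges G) i)))

    V≤ : ∣ V ∣ ≤ length xs
    V≤ = subst (_≤ length xs) (sym (∣tabulate∣ in-xs? id))
      (length-⊆ Fin._≟_ xs (Unique.filter⁺ in-xs? (Unique.allFin⁺ n))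
        (proj₂ ∘ ∈-filter⁻ in-xs? {xs = allFin n}))

    xs≤V : length xs ≤ ∣ V ∣
    xs≤V = subst (length xs ≤_) (sym (∣tabulate∣ in-xs? id))
      (length-⊆ Fin._≟_ (filter in-xs? (allFin n)) u λ x∈ → ∈-filter⁺ in-xs? (∈-allFin _) x∈)

    nonempty : NonZero ∣ V ∣
    nonempty = >-nonZero (ℕ.<-≤-trans ne xs≤V)

    ∣E∣≡ : ∣ E ∣ ≡ length (filter both? (edges G))
    ∣E∣≡ = trans (∣tabulate∣ both? (List.lookup (edges G)))
      (cong (λ es → length (filter both? es)) (List.tabulate-lookup (edges G)))

    pairs≤ : length (filter (edge? G) (cartesianProduct xs xs)) ≤ ∣ E ∣
    pairs≤ = subst (_ ≤_) (sym ∣E∣≡)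
      (length-⊆ (×.≡-dec Fin._≟_ Fin._≟_) (filter both? (edges G))
        (Unique.filter⁺ (edge? G) (Unique.cartesianProduct⁺ u u))
        λ {e} e∈ → let e∈xs² , edge = ∈-filter⁻ (edge? G) {xs = cartesianProduct xs xs} e∈ in
          ∈-filter⁺ both?
            (∈-filter⁺ (edge? G) (∈-cartesianProduct⁺ (∈-allFin (proj₁ e)) (∈-allFin (proj₂ e))) edge)
            (∈-cartesianProduct⁻ xs xs e∈xs²))

    S : Subgraph G
    S = record
      { verts = V ; edgs = E ; nonempty = nonempty
      ; closed = λ i i∈E → let x∈ , y∈ = ∈-tabulate⁻ both? (List.lookup (edges G)) i∈E in
          ∈-tabulate⁺ in-xs? id x∈ , ∈-tabulate⁺ in-xs? id y∈ }

-- Homomorphisms to SP₉⁺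

module _ {n : ℕ} where

  -- The sign by which switching the vertices vs in turn multiplies the edges at x.
  switching : List (Fin n) → Fin n → Sign
  switching [] x = Sign.+
  switching (v ∷ vs) x = (if does (x Fin.≟ v) then Sign.- else Sign.+) Sign.* switching vs x

  switching-∉ : ∀ {vs x} → x ∉ vs → switching vs x ≡ Sign.+
  switching-∉ {[]} _ = refl
  switching-∉ {v ∷ vs} {x} x∉ with x Fin.≟ v
  ... | yes x≡v = contradiction (here x≡v) x∉
  ... | no _ = switching-∉ (x∉ ∘ there)

  switching-∈ : ∀ {vs x} → Unique vs → x ∈ vs → switching vs x ≡ Sign.-
  switching-∈ {v ∷ vs} {x} (v∉ ∷ u) x∈ with x Fin.≟ v
  ... | yes refl = cong opposite (switching-∉ λ x∈vs → All.lookup v∉ x∈vs refl)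
  ... | no x≢v with x∈
  ...   | here x≡v = contradiction x≡v x≢v
  ...   | there x∈vs = switching-∈ u x∈vs

  adj-switch : ∀ (G : SignedGraph n) v {x y s} → adj (switch v G) x y ≡ just s →
    ∃ λ t → adj G x y ≡ just t ×
      s ≡ switching (v ∷ []) x Sign.* (t Sign.* switching (v ∷ []) y)
  adj-switch G v {x} {y} {s} eq with x Fin.≟ v | y Fin.≟ v
  ... | no _ | no _ = s , eq , sym (Sign.*-identityʳ s)
  ... | yes refl | yes refl =
    contradiction (trans (sym (cong (Maybe.map opposite) (adj-irrefl G x))) eq) λ ()
  ... | yes _ | no _ with adj G x y | eq
  ...   | just t | refl = t , refl , cong opposite (sym (Sign.*-identityʳ t))
  adj-switch G v {x} {y} {s} eq | no _ | yes _ with adj G x y | eq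
  ...   | just t | refl = t , refl , trans (sym (Sign.*-identityˡ _)) (Sign.*-comm Sign.- t)

  adj-switches : ∀ (G : SignedGraph n) vs {x y s} → adj (List.foldl (flip switch) G vs) x y ≡ just s →
    ∃ λ t → adj G x y ≡ just t × s ≡ switching vs x Sign.* (t Sign.* switching vs y)
  adj-switches G [] {s = s} eq = s , eq , sym (Sign.*-identityʳ s)
  adj-switches G (v ∷ vs) {x} {y} eq =
    case adj-switches (switch v G) vs {x} {y} eq of λ where
      (t , eq₁ , refl) → case adj-switch G v {x} {y} eq₁ of λ where
        (r , eq₂ , refl) → r , eq₂ , regroup
          (if does (x Fin.≟ v) then Sign.- else Sign.+) (switching vs x) r
          (if does (y Fin.≟ v) then Sign.- else Sign.+) (switching vs y)
    where
    regroup : ∀ a b r c d → b Sign.* (((a Sign.* Sign.+) Sign.* (r Sign.* (c Sign.* Sign.+))) Sign.* d) ≡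
                            (a Sign.* b) Sign.* (r Sign.* (c Sign.* d))
    regroup a b r c d rewrite Sign.*-identityʳ a | Sign.*-identityʳ c
      | Sign.*-assoc a (r Sign.* c) d | Sign.*-assoc r c d
      | sym (Sign.*-assoc b a (r Sign.* (c Sign.* d))) | Sign.*-comm a b = refl

  -- The signs in the colors say where to switch; after that, the underlying vertices form a
  -- sign-preserving map.
  homomorphism : ∀ (G : SignedGraph n) → ∃ (Graph.Proper G) → G ⟶ SP₉ ⁺
  homomorphism G (c , proper) = record
    { φ = proj₁ ∘ c
    ; G′ = List.foldl (flip switch) G negative
    ; G∼G′ = negative , λ _ _ → refl
    ; preserves = λ u v s eq → case adj-switches G negative {u} {v} eq of λ where
        (t , eq , refl) → trans (entry-correct (proj₁ (c u)) (proj₁ (c v))) (joined u v t eq)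
    }
    where
    negative? : ∀ x → Dec (proj₂ (c x) ≡ Sign.-)
    negative? x = proj₂ (c x) Sign.≟ Sign.-

    negative : List (Fin n)
    negative = filter negative? (allFin n)

    switching-negative : ∀ x → switching negative x ≡ proj₂ (c x)
    switching-negative x = case negative? x of λ where
        (yes eq) → trans (switching-∈ (Unique.filter⁺ negative? (Unique.allFin⁺ n))
                                      (∈-filter⁺ negative? (∈-allFin x) eq)) (sym eq)
        (no ≢-) → trans (switching-∉ λ x∈ → ≢- (proj₂ (∈-filter⁻ negative? {xs = allFin n} x∈)))
                        (positive (proj₂ (c x)) ≢-)
      where
      positive : ∀ s → s ≢ Sign.- → Sign.+ ≡ s
      positive Sign.+ _  = refl
      positive Sign.- ≢- = contradiction refl ≢-

    isJust-sound : ∀ m {s} → T (isJust m s) → m ≡ just s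
    isJust-sound (just Sign.+) {Sign.+} _ = refl
    isJust-sound (just Sign.-) {Sign.-} _ = refl

    joined : ∀ u v t → adj G u v ≡ just t →
      entry (proj₁ (c u)) (proj₁ (c v)) ≡
        just (switching negative u Sign.* (t Sign.* switching negative v))
    joined u v t eq = isJust-sound (entry (proj₁ (c u)) (proj₁ (c v)))
      (subst₂ (λ s s′ → T (isJust (entry (proj₁ (c u)) (proj₁ (c v))) (s Sign.* (t Sign.* s′))))
        (sym (switching-negative u)) (sym (switching-negative v))
        (subst (λ m → T (pos (c u) (fromMaybe Sign.+ m ∙ c v))) eq
          (Pos.holds (proper u v λ none → contradiction (trans (sym none) eq) λ ()))))

-- `P` need not be decidable, so the search downward from `b` decides each `P b` only under a double
-- negation.
¬¬-maximum : ∀ {P : ℕ → Set} b {k₀} → P k₀ → (∀ j → P j → j ≤ b) →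
             ¬ ¬ (∃ λ k → IsMaximum P k × k ≤ b)
¬¬-maximum {P} b {k₀} pk₀ bound ¬max = ¬¬-excluded-middle {A = P b} λ where
    (yes pb) → ¬max (b , (pb , bound) , ℕ.≤-refl)
    (no ¬pb) → smaller b bound ¬max ¬pb
  where
  smaller : ∀ b → (∀ j → P j → j ≤ b) → ¬ (∃ λ k → IsMaximum P k × k ≤ b) → ¬ ¬ P b
  smaller zero bound _ ¬p0 = ¬p0 (subst P (ℕ.n≤0⇒n≡0 (bound _ pk₀)) pk₀)
  smaller (suc b) bound ¬max ¬pb = ¬¬-maximum b pk₀
    (λ j pj → ℕ.≤-pred (ℕ.≤∧≢⇒< (bound j pj) λ { refl → ¬pb pj }))
    λ (k , kmax , k≤b) → ¬max (k , kmax , ℕ.m≤n⇒m≤1+n k≤b)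

theorem3 : (∀ (n : ℕ) (G : SignedGraph n) → mad G ℚ.< (ℤ.+ 17) / 5 → G ⟶ SP₉ ⁺)
    × ¬ ¬ (∃ λ (k : ℕ) → IsClassChromaticNumber (𝓜 ((ℤ.+ 17) / 5)) k × k ≤ 10)
-- The graph without vertices attains the value 0, so the set of chromatic numbers is inhabited;
-- `SP₉ ⁺`, of order 10, bounds it.
theorem3 = homomorphic , ¬¬-maximum 10 (0 , empty , empty-sparse , (empty , identity) , λ _ _ → z≤n)
    λ k (n , G , sparse , _ , least) → least 10 (SP₉ ⁺ , homomorphic n G sparse)
  where
  homomorphic : ∀ n (G : SignedGraph n) → mad G ℚ.< (ℤ.+ 17) / 5 → G ⟶ SP₉ ⁺
  homomorphic n G mad< = homomorphism G (color _ G ℕ.≤-refl (mad⇒sparse G mad<))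

  empty : SignedGraph 0
  empty = record { adj = λ () ; adj-sym = λ () ; adj-irrefl = λ () }

  empty-sparse : mad empty ℚ.< (ℤ.+ 17) / 5
  empty-sparse = ℚ.*<* (ℤ.+<+ (s≤s z≤n))

  identity : empty ⟶ empty
  identity = record { φ = λ () ; G′ = empty ; G∼G′ = [] , λ () ; preserves = λ () }
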